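{- For every two graphs $G$ and $H$, $$\mathrm{pw}(G \uplus H) \leq \max\left(\mathrm{pw}(G), \mathrm{pw}(H), \frac{1}{\sqrt{3}}\bigl(\mathrm{pw}(G) + \mathrm{pw}(H)\bigr)\right).$$
   Context: All graphs are finite, simple and undirected, and have at least one edge. $G \uplus H$ denotes the disjoint union of the graphs $G$ and $H$. Let $d$ be the Euclidean distance in the plane. A realization of a graph $G=(V,E)$ is a (not necessarily injective) function $r: V \to \mathbb{R}^2$ such that $d(r(u),r(v)) \ge 1$ for every edge $\{u,v\} \in E$. The width of a realization is the maximum of $d(r(u),r(v))$ over all $u,v \in V$. The plane-width $\mathrm{pw}(G)$ is the minimum width of all realizations of $G$. -}

module Defs where

open import Level using (0ℓ)
open import Data.Nat as ℕ using (ℕ; zero; suc)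
import Data.Nat.Properties as ℕₚ
open import Data.Integer as ℤ using (+_; -[1+_])
import Data.Integer.Properties as ℤₚ
import Data.Rational as Q
open Q using (ℚ; mkℚ; 0ℚ; 1ℚ; ½; toℚᵘ)
import Data.Rational.Properties as ℚₚ
import Data.Rational.Unnormalised as ℚᵘ
import Data.Rational.Unnormalised.Properties as ℚᵘₚ
open import Data.Rational.Solver using (module +-*-Solver)
open import Data.Fin using (Fin)
open import Data.Fin.Properties using (+↔⊎)
open import Data.List using (List; map; foldr; allFin; cartesianProduct)
open import Data.Product using (∃-syntax; _×_; _,_; proj₁; proj₂)
open import Data.Sum using (_⊎_; inj₁; inj₂)
open import Data.Sum.Function.Propositional using (_⊎-↔_)
open import Data.Sum.Relation.Binary.Pointwise using (Pointwise; ⊎-symmetric; inj₁; inj₂)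
open import Function.Bundles using (_↔_; Inverse)
open import Function.Construct.Composition using (_↔-∘_)
open import Function.Construct.Symmetry using (↔-sym)
open import Relation.Binary using (Rel; Symmetric; Irreflexive)
open import Relation.Nullary using (yes; no; contradiction)
open import Relation.Binary.PropositionalEquality
  using (_≡_; refl; sym; trans; cong; cong₂; subst; module ≡-Reasoning)

module S = +-*-Solver

0<1 : 0ℚ Q.< 1ℚ
0<1 = ℚₚ.positive⁻¹ 1ℚ

∣-∣≤⇒≤ : ∀ {p q e} → Q.∣ p Q.- q ∣ Q.≤ e → p Q.≤ q Q.+ e
∣-∣≤⇒≤ {p} {q} {e} h = begin
  p                       ≡⟨ S.solve 2 (λ p q → p S.:= q S.:+ (p S.:- q)) refl p q ⟩
  q Q.+ (p Q.- q)         ≤⟨ ℚₚ.+-monoʳ-≤ q (p≤∣p∣ (p Q.- q)) ⟩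
  q Q.+ Q.∣ p Q.- q ∣     ≤⟨ ℚₚ.+-monoʳ-≤ q h ⟩
  q Q.+ e                 ∎
  where
  open ℚₚ.≤-Reasoning
  p≤∣p∣ : ∀ p → p Q.≤ Q.∣ p ∣
  p≤∣p∣ p with ℚₚ.≤-total 0ℚ p
  ... | inj₁ 0≤p = ℚₚ.≤-reflexive (sym (ℚₚ.0≤p⇒∣p∣≡p 0≤p))
  ... | inj₂ p≤0 = ℚₚ.≤-trans p≤0 (ℚₚ.0≤∣p∣ p)

≤⇒∣-∣≤ : ∀ {p q e} → p Q.≤ q Q.+ e → q Q.≤ p Q.+ e → Q.∣ p Q.- q ∣ Q.≤ e
≤⇒∣-∣≤ {p} {q} {e} h k with ℚₚ.∣p∣≡p∨∣p∣≡-p (p Q.- q)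
... | inj₁ eq = begin
  Q.∣ p Q.- q ∣      ≡⟨ eq ⟩
  p Q.- q            ≤⟨ ℚₚ.+-monoˡ-≤ (Q.- q) h ⟩
  (q Q.+ e) Q.- q    ≡⟨ S.solve 2 (λ q e → (q S.:+ e) S.:- q S.:= e) refl q e ⟩
  e                  ∎ where open ℚₚ.≤-Reasoning
... | inj₂ eq = begin
  Q.∣ p Q.- q ∣      ≡⟨ eq ⟩
  Q.- (p Q.- q)      ≡⟨ S.solve 2 (λ p q → S.:- (p S.:- q) S.:= q S.:- p) refl p q ⟩
  q Q.- p            ≤⟨ ℚₚ.+-monoˡ-≤ (Q.- p) k ⟩
  (p Q.+ e) Q.- p    ≡⟨ S.solve 2 (λ q e → (q S.:+ e) S.:- q S.:= e) refl p e ⟩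
  e                  ∎ where open ℚₚ.≤-Reasoning

*-mono : ∀ {a b c d} → 0ℚ Q.≤ b → 0ℚ Q.≤ c → a Q.≤ b → c Q.≤ d → a Q.* c Q.≤ b Q.* d
*-mono {a} {b} {c} {d} 0≤b 0≤c a≤b c≤d = ℚₚ.≤-trans
  (ℚₚ.*-monoʳ-≤-nonNeg c {{Q.nonNegative 0≤c}} a≤b)
  (ℚₚ.*-monoˡ-≤-nonNeg b {{Q.nonNegative 0≤b}} c≤d)

*-pos : ∀ {a b} → 0ℚ Q.< a → 0ℚ Q.< b → 0ℚ Q.< a Q.* b
*-pos {a} {b} 0<a 0<b = ℚₚ.positive⁻¹ (a Q.* b)
  {{ℚₚ.pos*pos⇒pos a {{Q.positive 0<a}} b {{Q.positive 0<b}}}}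

sq-mono : ∀ {a b} → 0ℚ Q.≤ a → a Q.≤ b → a Q.* a Q.≤ b Q.* b
sq-mono 0≤a a≤b = *-mono (ℚₚ.≤-trans 0≤a a≤b) 0≤a a≤b a≤b

0<⊔ : ∀ {δ} → 0ℚ Q.< δ → ∀ a → 0ℚ Q.< a Q.⊔ δ
0<⊔ {δ} 0<δ a = ℚₚ.<-≤-trans 0<δ (ℚₚ.p≤q⊔p a δ)

half : ∀ ε → ½ Q.* ε Q.+ ½ Q.* ε ≡ ε
half ε = trans (sym (ℚₚ.*-distribʳ-+ ε ½ ½)) (ℚₚ.*-identityˡ ε)

0<half : ∀ {ε} → 0ℚ Q.< ε → 0ℚ Q.< ½ Q.* ε
0<half = *-pos (ℚₚ.positive⁻¹ ½)

recipℚ : (p : ℚ) → 0ℚ Q.< p → ℚ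
recipℚ p 0<p = Q.1/_ p {{Q.>-nonZero 0<p}}

recipℚ-pos : ∀ p (0<p : 0ℚ Q.< p) → 0ℚ Q.< recipℚ p 0<p
recipℚ-pos p 0<p = ℚₚ.positive⁻¹ _ {{ℚₚ.1/pos⇒pos p {{Q.positive 0<p}}}}

recipℚ-inv : ∀ p (0<p : 0ℚ Q.< p) → p Q.* recipℚ p 0<p ≡ 1ℚ
recipℚ-inv p 0<p = ℚₚ.*-inverseʳ p {{Q.>-nonZero 0<p}}

fromℕ : ℕ → ℚ
fromℕ n = + n Q./ 1

fromℕ-suc : ∀ n → fromℕ (suc n) ≡ 1ℚ Q.+ fromℕ n
fromℕ-suc n = ℚₚ.toℚᵘ-injective (begin
  toℚᵘ (fromℕ (suc n))           ≈⟨ ℚₚ.toℚᵘ-fromℚᵘ (ℚᵘ.mkℚᵘ (+ suc n) 0) ⟩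
  ℚᵘ.mkℚᵘ (+ suc n) 0            ≈⟨ ℚᵘ.*≡* (cong (ℤ._* + 1) (sym (cong (λ z → + 1 ℤ.+ z) (ℤₚ.*-identityʳ (+ n))))) ⟩
  toℚᵘ 1ℚ ℚᵘ.+ ℚᵘ.mkℚᵘ (+ n) 0   ≈⟨ ℚᵘₚ.+-congʳ (toℚᵘ 1ℚ) (ℚᵘₚ.≃-sym (ℚₚ.toℚᵘ-fromℚᵘ (ℚᵘ.mkℚᵘ (+ n) 0))) ⟩
  toℚᵘ 1ℚ ℚᵘ.+ toℚᵘ (fromℕ n)    ≈⟨ ℚᵘₚ.≃-sym (ℚₚ.toℚᵘ-homo-+ 1ℚ (fromℕ n)) ⟩
  toℚᵘ (1ℚ Q.+ fromℕ n)          ∎)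
  where open ℚᵘₚ.≃-Reasoning

0≤fromℕ : ∀ n → 0ℚ Q.≤ fromℕ n
0≤fromℕ zero    = ℚₚ.≤-refl
0≤fromℕ (suc n) = subst (0ℚ Q.≤_) (sym (fromℕ-suc n))
  (ℚₚ.+-mono-≤ (ℚₚ.<⇒≤ 0<1) (0≤fromℕ n))

0<fromℕ : ∀ n → 0ℚ Q.< fromℕ (suc n)
0<fromℕ n = subst (0ℚ Q.<_) (sym (fromℕ-suc n))
  (ℚₚ.+-mono-<-≤ 0<1 (0≤fromℕ n))

fromℕ-mono : ∀ {m n} → m ℕ.≤ n → fromℕ m Q.≤ fromℕ n
fromℕ-mono {n = n} ℕ.z≤n = 0≤fromℕ n
fromℕ-mono {suc m} {suc n} (ℕ.s≤s le) = begin
  fromℕ (suc m)      ≡⟨ fromℕ-suc m ⟩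
  1ℚ Q.+ fromℕ m     ≤⟨ ℚₚ.+-monoʳ-≤ 1ℚ (fromℕ-mono le) ⟩
  1ℚ Q.+ fromℕ n     ≡⟨ sym (fromℕ-suc n) ⟩
  fromℕ (suc n)      ∎ where open ℚₚ.≤-Reasoning

fromℕ-+ : ∀ m n → fromℕ (m ℕ.+ n) ≡ fromℕ m Q.+ fromℕ n
fromℕ-+ zero    n = sym (ℚₚ.+-identityˡ (fromℕ n))
fromℕ-+ (suc m) n = begin
  fromℕ (suc (m ℕ.+ n))             ≡⟨ fromℕ-suc (m ℕ.+ n) ⟩
  1ℚ Q.+ fromℕ (m ℕ.+ n)            ≡⟨ cong (1ℚ Q.+_) (fromℕ-+ m n) ⟩
  1ℚ Q.+ (fromℕ m Q.+ fromℕ n)      ≡⟨ sym (ℚₚ.+-assoc 1ℚ (fromℕ m) (fromℕ n)) ⟩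
  (1ℚ Q.+ fromℕ m) Q.+ fromℕ n      ≡⟨ cong (Q._+ fromℕ n) (sym (fromℕ-suc m)) ⟩
  fromℕ (suc m) Q.+ fromℕ n         ∎ where open ≡-Reasoning

fromℕ-* : ∀ m n → fromℕ (m ℕ.* n) ≡ fromℕ m Q.* fromℕ n
fromℕ-* zero    n = sym (ℚₚ.*-zeroˡ (fromℕ n))
fromℕ-* (suc m) n = begin
  fromℕ (n ℕ.+ m ℕ.* n)             ≡⟨ fromℕ-+ n (m ℕ.* n) ⟩
  fromℕ n Q.+ fromℕ (m ℕ.* n)       ≡⟨ cong (fromℕ n Q.+_) (fromℕ-* m n) ⟩
  fromℕ n Q.+ fromℕ m Q.* fromℕ n   ≡⟨ cong (Q._+ fromℕ m Q.* fromℕ n) (sym (ℚₚ.*-identityˡ (fromℕ n))) ⟩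
  1ℚ Q.* fromℕ n Q.+ fromℕ m Q.* fromℕ n ≡⟨ sym (ℚₚ.*-distribʳ-+ (fromℕ n) 1ℚ (fromℕ m)) ⟩
  (1ℚ Q.+ fromℕ m) Q.* fromℕ n      ≡⟨ cong (Q._* fromℕ n) (sym (fromℕ-suc m)) ⟩
  fromℕ (suc m) Q.* fromℕ n         ∎ where open ≡-Reasoning

natBound : ℚ → ℕ
natBound p = ℤ.∣ Q.↥ p ∣

≤natBound : ∀ p → p Q.≤ fromℕ (natBound p)
≤natBound p@(mkℚ n d-1 _) = ℚₚ.toℚᵘ-cancel-≤
  (ℚᵘₚ.≤-respʳ-≃ (ℚᵘₚ.≃-sym (ℚₚ.toℚᵘ-fromℚᵘ (ℚᵘ.mkℚᵘ (+ ℤ.∣ n ∣) 0)))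
    (ℚᵘ.*≤* (le n)))
  where
  le : ∀ n → n ℤ.* + 1 ℤ.≤ + ℤ.∣ n ∣ ℤ.* + suc d-1
  le (+ k) = subst (ℤ._≤ + k ℤ.* + suc d-1) (sym (ℤₚ.*-identityʳ (+ k)))
    (subst (+ k ℤ.≤_) (ℤₚ.pos-* k (suc d-1)) (ℤ.+≤+ (ℕₚ.m≤m*n k (suc d-1))))
  le -[1+ k ] = subst (-[1+ k ] ℤ.* + 1 ℤ.≤_) (ℤₚ.pos-* (suc k) (suc d-1)) ℤ.-≤+

mesh : ℕ → ℚ
mesh n = recipℚ (fromℕ (suc n)) (0<fromℕ n)

0<mesh : ∀ n → 0ℚ Q.< mesh n
0<mesh n = recipℚ-pos (fromℕ (suc n)) (0<fromℕ n)

mesh-small : ∀ ε → 0ℚ Q.< ε → ∃[ N ] ∀ n → N ℕ.≤ n → mesh n Q.≤ ε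
mesh-small ε 0<ε = natBound ε⁻¹ , λ n N≤n → begin
  mesh n                        ≡⟨ sym (ℚₚ.*-identityʳ (mesh n)) ⟩
  mesh n Q.* 1ℚ                 ≡⟨ cong (mesh n Q.*_) (sym (recipℚ-inv ε 0<ε)) ⟩
  mesh n Q.* (ε Q.* ε⁻¹)        ≡⟨ S.solve 3 (λ a b c → a S.:* (b S.:* c) S.:= a S.:* b S.:* c) refl (mesh n) ε ε⁻¹ ⟩
  mesh n Q.* ε Q.* ε⁻¹          ≤⟨ *-mono (0≤mε n) (ℚₚ.<⇒≤ (recipℚ-pos ε 0<ε)) ℚₚ.≤-refl
                                     (ℚₚ.≤-trans (≤natBound ε⁻¹) (fromℕ-mono (ℕₚ.m≤n⇒m≤1+n N≤n))) ⟩
  mesh n Q.* ε Q.* fromℕ (suc n) ≡⟨ S.solve 3 (λ a b c → a S.:* b S.:* c S.:= (c S.:* a) S.:* b) refl (mesh n) ε (fromℕ (suc n)) ⟩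
  (fromℕ (suc n) Q.* mesh n) Q.* ε ≡⟨ cong (Q._* ε) (recipℚ-inv (fromℕ (suc n)) (0<fromℕ n)) ⟩
  1ℚ Q.* ε                      ≡⟨ ℚₚ.*-identityˡ ε ⟩
  ε                             ∎
  where
  open ℚₚ.≤-Reasoning
  ε⁻¹ = recipℚ ε 0<ε
  0≤mε : ∀ n → 0ℚ Q.≤ mesh n Q.* ε
  0≤mε n = ℚₚ.<⇒≤ (*-pos (0<mesh n) 0<ε)

-------------------------------------------------------------------------
-- The reals are Cauchy sequences of rationals, with termwise operations

Eventually : (ℕ → Set) → Set
Eventually P = ∃[ N ] ∀ n → N ℕ.≤ n → P n

IsCauchy : (ℕ → ℚ) → Set
IsCauchy x = ∀ ε → 0ℚ Q.< ε →
  ∃[ N ] ∀ m n → N ℕ.≤ m → N ℕ.≤ n → Q.∣ x m Q.- x n ∣ Q.≤ ε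

record ℝ : Set where
  constructor mkℝ
  field
    seq    : ℕ → ℚ
    cauchy : IsCauchy seq
open ℝ public

infix 4 _≤_ _<_ _≈_

-- Equality of reals is the setoid equality _≈_, never _≡_.
_≤_ _<_ _≈_ : Rel ℝ 0ℓ
x ≤ y = ∀ ε → 0ℚ Q.< ε → Eventually λ n → seq x n Q.≤ seq y n Q.+ ε
x < y = ∃[ δ ] 0ℚ Q.< δ × Eventually λ n → seq x n Q.+ δ Q.≤ seq y n
x ≈ y = x ≤ y × y ≤ x

-- A binary operation which is Lipschitz in the tails of x and y.
cauchy₂ : (f : ℚ → ℚ → ℚ) (x y : ℝ) (K L : ℚ) → 0ℚ Q.< K → 0ℚ Q.< L → (N₀ : ℕ) →
  (∀ m n → N₀ ℕ.≤ m → N₀ ℕ.≤ n →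
    Q.∣ f (seq x m) (seq y m) Q.- f (seq x n) (seq y n) ∣ Q.≤
    K Q.* Q.∣ seq x m Q.- seq x n ∣ Q.+ L Q.* Q.∣ seq y m Q.- seq y n ∣) →
  IsCauchy (λ n → f (seq x n) (seq y n))
cauchy₂ f x y K L 0<K 0<L N₀ lip ε 0<ε = N₀ ℕ.⊔ (N₁ ℕ.⊔ N₂) , λ m n N≤m N≤n →
  let le₀ = λ {k} (le : N₀ ℕ.⊔ (N₁ ℕ.⊔ N₂) ℕ.≤ k) → ℕₚ.m⊔n≤o⇒m≤o N₀ (N₁ ℕ.⊔ N₂) le
      le₁ = λ {k} (le : N₀ ℕ.⊔ (N₁ ℕ.⊔ N₂) ℕ.≤ k) → ℕₚ.m⊔n≤o⇒m≤o N₁ N₂ (ℕₚ.m⊔n≤o⇒n≤o N₀ (N₁ ℕ.⊔ N₂) le)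
      le₂ = λ {k} (le : N₀ ℕ.⊔ (N₁ ℕ.⊔ N₂) ℕ.≤ k) → ℕₚ.m⊔n≤o⇒n≤o N₁ N₂ (ℕₚ.m⊔n≤o⇒n≤o N₀ (N₁ ℕ.⊔ N₂) le)
  in begin
    Q.∣ f (seq x m) (seq y m) Q.- f (seq x n) (seq y n) ∣
      ≤⟨ lip m n (le₀ N≤m) (le₀ N≤n) ⟩
    K Q.* Q.∣ seq x m Q.- seq x n ∣ Q.+ L Q.* Q.∣ seq y m Q.- seq y n ∣
      ≤⟨ ℚₚ.+-mono-≤ (scale 0<K (cx m n (le₁ N≤m) (le₁ N≤n))) (scale 0<L (cy m n (le₂ N≤m) (le₂ N≤n))) ⟩
    ½ Q.* ε Q.+ ½ Q.* ε
      ≡⟨ half ε ⟩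
    ε ∎
  where
  open ℚₚ.≤-Reasoning
  tol : ∀ {K} → 0ℚ Q.< K → ℚ
  tol {K} 0<K = recipℚ K 0<K Q.* (½ Q.* ε)
  0<tol : ∀ {K} (0<K : 0ℚ Q.< K) → 0ℚ Q.< tol 0<K
  0<tol {K} 0<K = *-pos (recipℚ-pos K 0<K) (0<half 0<ε)
  scale : ∀ {K a} (0<K : 0ℚ Q.< K) → a Q.≤ tol 0<K → K Q.* a Q.≤ ½ Q.* ε
  scale {K} {a} 0<K a≤ = begin
    K Q.* a                                ≤⟨ ℚₚ.*-monoˡ-≤-nonNeg K {{Q.nonNegative (ℚₚ.<⇒≤ 0<K)}} a≤ ⟩
    K Q.* (recipℚ K 0<K Q.* (½ Q.* ε))     ≡⟨ sym (ℚₚ.*-assoc K (recipℚ K 0<K) (½ Q.* ε)) ⟩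
    (K Q.* recipℚ K 0<K) Q.* (½ Q.* ε)     ≡⟨ cong (Q._* (½ Q.* ε)) (recipℚ-inv K 0<K) ⟩
    1ℚ Q.* (½ Q.* ε)                       ≡⟨ ℚₚ.*-identityˡ (½ Q.* ε) ⟩
    ½ Q.* ε                                ∎
  X = cauchy x (tol 0<K) (0<tol 0<K)
  Y = cauchy y (tol 0<L) (0<tol 0<L)
  N₁ = proj₁ X
  N₂ = proj₁ Y
  cx = proj₂ X
  cy = proj₂ Y

bounded : ∀ x → ∃[ B ] 0ℚ Q.< B × Eventually λ n → Q.∣ seq x n ∣ Q.≤ B
bounded x = B , 0<B , N , λ n N≤n → begin
  Q.∣ seq x n ∣                                     ≡⟨ cong Q.∣_∣ (S.solve 2 (λ a b → a S.:= b S.:+ (a S.:- b)) refl (seq x n) (seq x N)) ⟩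
  Q.∣ seq x N Q.+ (seq x n Q.- seq x N) ∣           ≤⟨ ℚₚ.∣p+q∣≤∣p∣+∣q∣ (seq x N) (seq x n Q.- seq x N) ⟩
  Q.∣ seq x N ∣ Q.+ Q.∣ seq x n Q.- seq x N ∣       ≤⟨ ℚₚ.+-monoʳ-≤ Q.∣ seq x N ∣ (proj₂ C n N N≤n ℕₚ.≤-refl) ⟩
  B                                                 ∎
  where
  open ℚₚ.≤-Reasoning
  C = cauchy x 1ℚ 0<1
  N = proj₁ C
  B = Q.∣ seq x N ∣ Q.+ 1ℚ
  0<B : 0ℚ Q.< B
  0<B = ℚₚ.+-mono-≤-< (ℚₚ.0≤∣p∣ (seq x N)) 0<1

infixl 6 _+_ _-_ _⊔_
infixl 7 _*_
infix  8 -_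

opaque
  const-cauchy : ∀ q → IsCauchy (λ _ → q)
  const-cauchy q ε 0<ε = 0 , λ _ _ _ _ →
    subst (Q._≤ ε) (sym (cong Q.∣_∣ (ℚₚ.+-inverseʳ q))) (ℚₚ.<⇒≤ 0<ε)

fromℚ : ℚ → ℝ
fromℚ q = mkℝ (λ _ → q) (const-cauchy q)

0ℝ 1ℝ 3ℝ : ℝ
0ℝ = fromℚ 0ℚ
1ℝ = fromℚ 1ℚ
3ℝ = fromℚ (+ 3 Q./ 1)

opaque
  +-cauchy : ∀ x y → IsCauchy (λ n → seq x n Q.+ seq y n)
  +-cauchy x y = cauchy₂ Q._+_ x y 1ℚ 1ℚ 0<1 0<1 0 λ m n _ _ →
    let a = seq x m; a′ = seq x n; b = seq y m; b′ = seq y n in begin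
    Q.∣ (a Q.+ b) Q.- (a′ Q.+ b′) ∣       ≡⟨ cong Q.∣_∣ (S.solve 4 (λ a b a′ b′ → (a S.:+ b) S.:- (a′ S.:+ b′) S.:= (a S.:- a′) S.:+ (b S.:- b′)) refl a b a′ b′) ⟩
    Q.∣ (a Q.- a′) Q.+ (b Q.- b′) ∣       ≤⟨ ℚₚ.∣p+q∣≤∣p∣+∣q∣ (a Q.- a′) (b Q.- b′) ⟩
    Q.∣ a Q.- a′ ∣ Q.+ Q.∣ b Q.- b′ ∣     ≡⟨ sym (cong₂ Q._+_ (ℚₚ.*-identityˡ Q.∣ a Q.- a′ ∣) (ℚₚ.*-identityˡ Q.∣ b Q.- b′ ∣)) ⟩
    1ℚ Q.* Q.∣ a Q.- a′ ∣ Q.+ 1ℚ Q.* Q.∣ b Q.- b′ ∣ ∎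
    where open ℚₚ.≤-Reasoning

_+_ : ℝ → ℝ → ℝ
x + y = mkℝ (λ n → seq x n Q.+ seq y n) (+-cauchy x y)

opaque
  neg-cauchy : ∀ x → IsCauchy (λ n → Q.- seq x n)
  neg-cauchy x ε 0<ε =
    let (N , c) = cauchy x ε 0<ε in N , λ m n N≤m N≤n →
    subst (Q._≤ ε)
      (trans (sym (ℚₚ.∣-p∣≡∣p∣ (seq x m Q.- seq x n)))
        (cong Q.∣_∣ (ℚₚ.neg-distrib-+ (seq x m) (Q.- seq x n))))
      (c m n N≤m N≤n)

-_ : ℝ → ℝ
- x = mkℝ (λ n → Q.- seq x n) (neg-cauchy x)

_-_ : ℝ → ℝ → ℝ
x - y = x + (- y)

opaque
  *-cauchy : ∀ x y → IsCauchy (λ n → seq x n Q.* seq y n)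
  *-cauchy x y = cauchy₂ Q._*_ x y (proj₁ By) (proj₁ Bx) (proj₁ (proj₂ By)) (proj₁ (proj₂ Bx)) (Nx ℕ.⊔ Ny) λ m n N≤m N≤n →
    let a = seq x m; a′ = seq x n; b = seq y m; b′ = seq y n in begin
    Q.∣ a Q.* b Q.- a′ Q.* b′ ∣                               ≡⟨ cong Q.∣_∣ (S.solve 4 (λ a b a′ b′ → a S.:* b S.:- a′ S.:* b′ S.:= b S.:* (a S.:- a′) S.:+ a′ S.:* (b S.:- b′)) refl a b a′ b′) ⟩
    Q.∣ b Q.* (a Q.- a′) Q.+ a′ Q.* (b Q.- b′) ∣              ≤⟨ ℚₚ.∣p+q∣≤∣p∣+∣q∣ (b Q.* (a Q.- a′)) (a′ Q.* (b Q.- b′)) ⟩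
    Q.∣ b Q.* (a Q.- a′) ∣ Q.+ Q.∣ a′ Q.* (b Q.- b′) ∣        ≡⟨ cong₂ Q._+_ (ℚₚ.∣p*q∣≡∣p∣*∣q∣ b (a Q.- a′)) (ℚₚ.∣p*q∣≡∣p∣*∣q∣ a′ (b Q.- b′)) ⟩
    Q.∣ b ∣ Q.* Q.∣ a Q.- a′ ∣ Q.+ Q.∣ a′ ∣ Q.* Q.∣ b Q.- b′ ∣ ≤⟨ ℚₚ.+-mono-≤
      (ℚₚ.*-monoʳ-≤-nonNeg Q.∣ a Q.- a′ ∣ {{ℚₚ.∣-∣-nonNeg (a Q.- a′)}} (bndy m (ℕₚ.m⊔n≤o⇒n≤o Nx Ny N≤m)))
      (ℚₚ.*-monoʳ-≤-nonNeg Q.∣ b Q.- b′ ∣ {{ℚₚ.∣-∣-nonNeg (b Q.- b′)}} (bndx n (ℕₚ.m⊔n≤o⇒m≤o Nx Ny N≤n))) ⟩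
    proj₁ By Q.* Q.∣ a Q.- a′ ∣ Q.+ proj₁ Bx Q.* Q.∣ b Q.- b′ ∣ ∎
    where
    open ℚₚ.≤-Reasoning
    Bx : ∃[ B ] 0ℚ Q.< B × Eventually λ n → Q.∣ seq x n ∣ Q.≤ B
    Bx = bounded x
    By : ∃[ B ] 0ℚ Q.< B × Eventually λ n → Q.∣ seq y n ∣ Q.≤ B
    By = bounded y
    Nx Ny : ℕ
    Nx = proj₁ (proj₂ (proj₂ Bx))
    Ny = proj₁ (proj₂ (proj₂ By))
    bndx : ∀ n → Nx ℕ.≤ n → Q.∣ seq x n ∣ Q.≤ proj₁ Bx
    bndx = proj₂ (proj₂ (proj₂ Bx))
    bndy : ∀ n → Ny ℕ.≤ n → Q.∣ seq y n ∣ Q.≤ proj₁ By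
    bndy = proj₂ (proj₂ (proj₂ By))

_*_ : ℝ → ℝ → ℝ
x * y = mkℝ (λ n → seq x n Q.* seq y n) (*-cauchy x y)

⊔-shift : ∀ {a a′ b b′ e} → a Q.≤ a′ Q.+ e → b Q.≤ b′ Q.+ e → a Q.⊔ b Q.≤ (a′ Q.⊔ b′) Q.+ e
⊔-shift {a} {a′} {b} {b′} {e} h k = ℚₚ.⊔-lub
  (ℚₚ.≤-trans h (ℚₚ.+-monoˡ-≤ e (ℚₚ.p≤p⊔q a′ b′)))
  (ℚₚ.≤-trans k (ℚₚ.+-monoˡ-≤ e (ℚₚ.p≤q⊔p a′ b′)))

opaque
  ⊔-cauchy : ∀ x y → IsCauchy (λ n → seq x n Q.⊔ seq y n)
  ⊔-cauchy x y = cauchy-z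
    where
    z : ℕ → ℚ
    z n = seq x n Q.⊔ seq y n
    close : ∀ m n ε → Q.∣ seq x m Q.- seq x n ∣ Q.≤ ε → Q.∣ seq y m Q.- seq y n ∣ Q.≤ ε →
            z m Q.≤ z n Q.+ ε
    close m n ε h k = ⊔-shift {seq x m} {seq x n} {seq y m} {seq y n} {ε}
      (∣-∣≤⇒≤ {seq x m} {seq x n} h) (∣-∣≤⇒≤ {seq y m} {seq y n} k)
    cauchy-z : IsCauchy z
    cauchy-z ε 0<ε = M ℕ.⊔ N , λ m n l l′ → ≤⇒∣-∣≤ {z m} {z n} {ε}
      (close m n ε (cx m n (l≤ l) (l≤ l′)) (cy m n (r≤ l) (r≤ l′)))
      (close n m ε (cx n m (l≤ l′) (l≤ l)) (cy n m (r≤ l′) (r≤ l)))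
      where
      M N : ℕ
      M = proj₁ (cauchy x ε 0<ε)
      N = proj₁ (cauchy y ε 0<ε)
      cx : ∀ m n → M ℕ.≤ m → M ℕ.≤ n → Q.∣ seq x m Q.- seq x n ∣ Q.≤ ε
      cx = proj₂ (cauchy x ε 0<ε)
      cy : ∀ m n → N ℕ.≤ m → N ℕ.≤ n → Q.∣ seq y m Q.- seq y n ∣ Q.≤ ε
      cy = proj₂ (cauchy y ε 0<ε)
      l≤ : ∀ {k} → M ℕ.⊔ N ℕ.≤ k → M ℕ.≤ k
      l≤ = ℕₚ.m⊔n≤o⇒m≤o M N
      r≤ : ∀ {k} → M ℕ.⊔ N ℕ.≤ k → N ℕ.≤ k
      r≤ = ℕₚ.m⊔n≤o⇒n≤o M N

_⊔_ : ℝ → ℝ → ℝ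
x ⊔ y = mkℝ (λ n → seq x n Q.⊔ seq y n) (⊔-cauchy x y)

opaque
  recip-cauchy : ∀ x {δ} (0<δ : 0ℚ Q.< δ) → IsCauchy (λ n → recipℚ (seq x n Q.⊔ δ) (0<⊔ 0<δ (seq x n)))
  recip-cauchy x {δ} 0<δ ε 0<ε =
    let (N , c) = cauchy y ((δ Q.* δ) Q.* ε) (*-pos (*-pos 0<δ 0<δ) 0<ε)
    in N , λ m n N≤m N≤n → ≤⇒∣-∣≤ {r m} {r n} {ε}
         (close m n (ℚₚ.<⇒≤ 0<ε) (∣-∣≤⇒≤ {s n} {s m} (c n m N≤n N≤m)))
         (close n m (ℚₚ.<⇒≤ 0<ε) (∣-∣≤⇒≤ {s m} {s n} (c m n N≤m N≤n)))
    where
    open ℚₚ.≤-Reasoning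
    y : ℝ
    y = x ⊔ fromℚ δ
    s : ℕ → ℚ
    s = seq y
    0<s : ∀ n → 0ℚ Q.< s n
    0<s n = 0<⊔ 0<δ (seq x n)
    δ≤s : ∀ n → δ Q.≤ s n
    δ≤s n = ℚₚ.p≤q⊔p (seq x n) δ
    r : ℕ → ℚ
    r n = recipℚ (s n) (0<s n)
    inv : ∀ n → s n Q.* r n ≡ 1ℚ
    inv n = recipℚ-inv (s n) (0<s n)
    close : ∀ m n {ε} → 0ℚ Q.≤ ε → s n Q.≤ s m Q.+ (δ Q.* δ) Q.* ε → r m Q.≤ r n Q.+ ε
    close m n {ε} 0≤ε h = begin
      r m                                     ≡⟨ sym (ℚₚ.*-identityʳ (r m)) ⟩
      r m Q.* 1ℚ                              ≡⟨ cong (r m Q.*_) (sym (inv n)) ⟩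
      r m Q.* (s n Q.* r n)                   ≡⟨ S.solve 3 (λ a b c → a S.:* (b S.:* c) S.:= b S.:* (a S.:* c)) refl (r m) (s n) (r n) ⟩
      s n Q.* (r m Q.* r n)                   ≤⟨ ℚₚ.*-monoʳ-≤-nonNeg (r m Q.* r n) {{Q.nonNegative 0≤rr}}
                                                   (ℚₚ.≤-trans h (ℚₚ.+-monoʳ-≤ (s m) (ℚₚ.*-monoʳ-≤-nonNeg ε {{Q.nonNegative 0≤ε}}
                                                     (*-mono (ℚₚ.<⇒≤ (0<s m)) (ℚₚ.<⇒≤ 0<δ) (δ≤s m) (δ≤s n))))) ⟩
      (s m Q.+ (s m Q.* s n) Q.* ε) Q.* (r m Q.* r n)
        ≡⟨ S.solve 5 (λ a b c d e → (a S.:+ (a S.:* b) S.:* e) S.:* (c S.:* d) S.:=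
                                    (a S.:* c) S.:* d S.:+ (a S.:* c) S.:* (b S.:* d) S.:* e) refl (s m) (s n) (r m) (r n) ε ⟩
      (s m Q.* r m) Q.* r n Q.+ (s m Q.* r m) Q.* (s n Q.* r n) Q.* ε
        ≡⟨ cong₂ (λ p q → p Q.* r n Q.+ p Q.* q Q.* ε) (inv m) (inv n) ⟩
      1ℚ Q.* r n Q.+ 1ℚ Q.* 1ℚ Q.* ε          ≡⟨ cong₂ Q._+_ (ℚₚ.*-identityˡ (r n)) (ℚₚ.*-identityˡ ε) ⟩
      r n Q.+ ε                               ∎
      where
      0≤rr : 0ℚ Q.≤ r m Q.* r n
      0≤rr = ℚₚ.<⇒≤ (*-pos (recipℚ-pos (s m) (0<s m)) (recipℚ-pos (s n) (0<s n)))

-- For 0 < x with witness δ, seq x n ⊔ δ is positive and eventually equal to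
-- seq x n, so its termwise reciprocal represents 1/x.
recip : (x : ℝ) → 0ℝ < x → ℝ
recip x (δ , 0<δ , _) =
  mkℝ (λ n → recipℚ (seq x n Q.⊔ δ) (0<⊔ 0<δ (seq x n))) (recip-cauchy x 0<δ)

-- climb x h f s walks up from s in steps of h, at most f times, as long as the
-- square stays at most x.
climb : (x h : ℚ) → ℕ → ℚ → ℚ
climb x h zero    s = s
climb x h (suc f) s with (s Q.+ h) Q.* (s Q.+ h) ℚₚ.≤? x
... | yes _ = climb x h f (s Q.+ h)
... | no  _ = s

-- For 0 ≤ x: the largest multiple of 1/(n+1) whose square is at most x.  The
-- number of steps allowed is large enough never to be used up.
opaque
  rootℚ : ℚ → ℕ → ℚ
  rootℚ x n = climb x (mesh n) (suc (natBound x) ℕ.* suc n) 0ℚ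

module _ {x h : ℚ} (0<h : 0ℚ Q.< h) where

  climb-spec : ∀ f s → 0ℚ Q.≤ s → s Q.* s Q.≤ x →
    x Q.< (s Q.+ fromℕ f Q.* h) Q.* (s Q.+ fromℕ f Q.* h) →
    let r = climb x h f s in
    0ℚ Q.≤ r × r Q.* r Q.≤ x × x Q.< (r Q.+ h) Q.* (r Q.+ h)
  climb-spec zero s 0≤s lo hi = contradiction (ℚₚ.<-≤-trans hi
    (ℚₚ.≤-trans (ℚₚ.≤-reflexive (cong (λ z → z Q.* z) (trans (cong (s Q.+_) (ℚₚ.*-zeroˡ h)) (ℚₚ.+-identityʳ s)))) lo))
    (ℚₚ.<-irrefl refl)
  climb-spec (suc f) s 0≤s lo hi with (s Q.+ h) Q.* (s Q.+ h) ℚₚ.≤? x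
  ... | no ≰  = 0≤s , lo , ℚₚ.≰⇒> ≰
  ... | yes lo′ = climb-spec f (s Q.+ h) (ℚₚ.+-mono-≤ 0≤s (ℚₚ.<⇒≤ 0<h)) lo′
    (subst (λ z → x Q.< z Q.* z) (begin
      s Q.+ fromℕ (suc f) Q.* h        ≡⟨ cong (λ z → s Q.+ z Q.* h) (fromℕ-suc f) ⟩
      s Q.+ (1ℚ Q.+ fromℕ f) Q.* h     ≡⟨ cong (s Q.+_) (ℚₚ.*-distribʳ-+ h 1ℚ (fromℕ f)) ⟩
      s Q.+ (1ℚ Q.* h Q.+ fromℕ f Q.* h) ≡⟨ cong (λ z → s Q.+ (z Q.+ fromℕ f Q.* h)) (ℚₚ.*-identityˡ h) ⟩
      s Q.+ (h Q.+ fromℕ f Q.* h)      ≡⟨ sym (ℚₚ.+-assoc s h (fromℕ f Q.* h)) ⟩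
      (s Q.+ h) Q.+ fromℕ f Q.* h      ∎) hi)
    where open ≡-Reasoning

opaque
  unfolding rootℚ

  rootℚ-spec : ∀ x n → 0ℚ Q.≤ x → let r = rootℚ x n in
    0ℚ Q.≤ r × r Q.* r Q.≤ x × x Q.< (r Q.+ mesh n) Q.* (r Q.+ mesh n)
  rootℚ-spec x n 0≤x = climb-spec (0<mesh n) (suc (natBound x) ℕ.* suc n) 0ℚ ℚₚ.≤-refl 0≤x
    (subst (λ z → x Q.< z Q.* z) (sym top) (ℚₚ.<-≤-trans x<C C≤C²))
    where
    C : ℚ
    C = fromℕ (suc (natBound x))
    1≤C : 1ℚ Q.≤ C
    1≤C = fromℕ-mono {1} {suc (natBound x)} (ℕ.s≤s ℕ.z≤n)
    x<C : x Q.< C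
    x<C = subst (x Q.<_) (sym (fromℕ-suc (natBound x)))
      (ℚₚ.≤-<-trans (≤natBound x) (subst (Q._< 1ℚ Q.+ fromℕ (natBound x)) (ℚₚ.+-identityˡ _) (ℚₚ.+-monoˡ-< (fromℕ (natBound x)) 0<1)))
    C≤C² : C Q.≤ C Q.* C
    C≤C² = subst (Q._≤ C Q.* C) (ℚₚ.*-identityˡ C)
      (ℚₚ.*-monoʳ-≤-nonNeg C {{Q.nonNegative (ℚₚ.≤-trans (ℚₚ.<⇒≤ 0<1) 1≤C)}} 1≤C)
    top : 0ℚ Q.+ fromℕ (suc (natBound x) ℕ.* suc n) Q.* mesh n ≡ C
    top = begin
      0ℚ Q.+ fromℕ (suc (natBound x) ℕ.* suc n) Q.* mesh n  ≡⟨ ℚₚ.+-identityˡ _ ⟩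
      fromℕ (suc (natBound x) ℕ.* suc n) Q.* mesh n         ≡⟨ cong (Q._* mesh n) (fromℕ-* (suc (natBound x)) (suc n)) ⟩
      C Q.* fromℕ (suc n) Q.* mesh n                    ≡⟨ ℚₚ.*-assoc C (fromℕ (suc n)) (mesh n) ⟩
      C Q.* (fromℕ (suc n) Q.* mesh n)                  ≡⟨ cong (C Q.*_) (recipℚ-inv (fromℕ (suc n)) (0<fromℕ n)) ⟩
      C Q.* 1ℚ                                          ≡⟨ ℚₚ.*-identityʳ C ⟩
      C                                                 ∎
      where open ≡-Reasoning

-- If a² ≤ x ≤ y + η² and y < (b + h)², then a ≤ b + (h + η).
root-close : ∀ {a b x y h η} → 0ℚ Q.≤ a → 0ℚ Q.≤ b → 0ℚ Q.< h → 0ℚ Q.≤ η →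
  a Q.* a Q.≤ x → x Q.≤ y Q.+ η Q.* η → y Q.< (b Q.+ h) Q.* (b Q.+ h) →
  a Q.≤ b Q.+ (h Q.+ η)
root-close {a} {b} {x} {y} {h} {η} 0≤a 0≤b 0<h 0≤η lo mid hi
  with a ℚₚ.≤? b Q.+ (h Q.+ η)
... | yes a≤ = a≤
... | no  a≰ = contradiction (begin-strict
  a Q.* a                                      ≤⟨ lo ⟩
  x                                            ≤⟨ mid ⟩
  y Q.+ η Q.* η                                <⟨ ℚₚ.+-monoˡ-< (η Q.* η) hi ⟩
  t Q.* t Q.+ η Q.* η                          ≡⟨ sym (ℚₚ.+-identityʳ _) ⟩
  (t Q.* t Q.+ η Q.* η) Q.+ 0ℚ                 ≤⟨ ℚₚ.+-monoʳ-≤ (t Q.* t Q.+ η Q.* η) 0≤tη ⟩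
  (t Q.* t Q.+ η Q.* η) Q.+ (t Q.* η Q.+ t Q.* η)
    ≡⟨ S.solve 3 (λ b h η → let t = b S.:+ h in
         (t S.:* t S.:+ η S.:* η) S.:+ (t S.:* η S.:+ t S.:* η) S.:=
         (b S.:+ (h S.:+ η)) S.:* (b S.:+ (h S.:+ η))) refl b h η ⟩
  (b Q.+ (h Q.+ η)) Q.* (b Q.+ (h Q.+ η))      ≤⟨ sq-mono 0≤b+ (ℚₚ.<⇒≤ (ℚₚ.≰⇒> a≰)) ⟩
  a Q.* a                                      ∎) (ℚₚ.<-irrefl refl)
  where
  open ℚₚ.≤-Reasoning
  t = b Q.+ h
  0≤t : 0ℚ Q.≤ t
  0≤t = ℚₚ.+-mono-≤ 0≤b (ℚₚ.<⇒≤ 0<h)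
  0≤tη′ : 0ℚ Q.≤ t Q.* η
  0≤tη′ = subst (Q._≤ t Q.* η) (ℚₚ.*-zeroˡ η) (ℚₚ.*-monoʳ-≤-nonNeg η {{Q.nonNegative 0≤η}} 0≤t)
  0≤tη : 0ℚ Q.≤ t Q.* η Q.+ t Q.* η
  0≤tη = ℚₚ.+-mono-≤ 0≤tη′ 0≤tη′
  0≤b+ : 0ℚ Q.≤ b Q.+ (h Q.+ η)
  0≤b+ = ℚₚ.+-mono-≤ 0≤b (ℚₚ.+-mono-≤ (ℚₚ.<⇒≤ 0<h) 0≤η)

opaque
  √-cauchy : ∀ x → IsCauchy (λ n → rootℚ (seq x n Q.⊔ 0ℚ) n)
  √-cauchy x = cauchy-r
    where
    y : ℝ
    y = x ⊔ 0ℝ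
    r : ℕ → ℚ
    r n = rootℚ (seq y n) n
    spec : ∀ n → 0ℚ Q.≤ r n × r n Q.* r n Q.≤ seq y n ×
                 seq y n Q.< (r n Q.+ mesh n) Q.* (r n Q.+ mesh n)
    spec n = rootℚ-spec (seq y n) n (ℚₚ.p≤q⊔p (seq x n) 0ℚ)
    close : ∀ {η} → 0ℚ Q.< η → ∀ m n → mesh n Q.≤ η →
            Q.∣ seq y m Q.- seq y n ∣ Q.≤ η Q.* η → r m Q.≤ r n Q.+ (η Q.+ η)
    close {η} 0<η m n m≤η le = ℚₚ.≤-trans
      (root-close {r m} {r n} {seq y m} {seq y n} (proj₁ (spec m)) (proj₁ (spec n)) (0<mesh n) (ℚₚ.<⇒≤ 0<η)
        (proj₁ (proj₂ (spec m))) (∣-∣≤⇒≤ {seq y m} {seq y n} le) (proj₂ (proj₂ (spec n))))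
      (ℚₚ.+-monoʳ-≤ (r n) (ℚₚ.+-monoˡ-≤ η m≤η))
    cauchy-r : IsCauchy r
    cauchy-r ε 0<ε = M ℕ.⊔ N , λ m n l l′ →
      subst (Q.∣ r m Q.- r n ∣ Q.≤_) (half ε) (≤⇒∣-∣≤ {r m} {r n}
        (close 0<η m n (small n (r≤ l′)) (c m n (l≤ l) (l≤ l′)))
        (close 0<η n m (small m (r≤ l)) (c n m (l≤ l′) (l≤ l))))
      where
      η : ℚ
      η = ½ Q.* ε
      0<η : 0ℚ Q.< η
      0<η = 0<half 0<ε
      cauchy-y : ∃[ M ] ∀ m n → M ℕ.≤ m → M ℕ.≤ n → Q.∣ seq y m Q.- seq y n ∣ Q.≤ η Q.* η
      cauchy-y = cauchy y (η Q.* η) (*-pos 0<η 0<η)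
      M N : ℕ
      M = proj₁ cauchy-y
      c : ∀ m n → M ℕ.≤ m → M ℕ.≤ n → Q.∣ seq y m Q.- seq y n ∣ Q.≤ η Q.* η
      c = proj₂ cauchy-y
      N = proj₁ (mesh-small η 0<η)
      small : ∀ n → N ℕ.≤ n → mesh n Q.≤ η
      small = proj₂ (mesh-small η 0<η)
      l≤ : ∀ {k} → M ℕ.⊔ N ℕ.≤ k → M ℕ.≤ k
      l≤ = ℕₚ.m⊔n≤o⇒m≤o M N
      r≤ : ∀ {k} → M ℕ.⊔ N ℕ.≤ k → N ℕ.≤ k
      r≤ = ℕₚ.m⊔n≤o⇒n≤o M N

-- Negative arguments are clipped to 0.
√ : ℝ → ℝ
√ x = mkℝ (λ n → rootℚ (seq x n Q.⊔ 0ℚ) n) (√-cauchy x)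

½≤-root : ∀ {x r h} → 0ℚ Q.≤ r → 0ℚ Q.≤ h → h Q.≤ ½ → 1ℚ Q.≤ x →
  x Q.< (r Q.+ h) Q.* (r Q.+ h) → ½ Q.≤ r
½≤-root {x} {r} {h} 0≤r 0≤h h≤½ 1≤x hi with ½ ℚₚ.≤? r
... | yes ½≤r = ½≤r
... | no  ½≰r = contradiction (begin-strict
  x                          <⟨ hi ⟩
  (r Q.+ h) Q.* (r Q.+ h)    ≤⟨ sq-mono (ℚₚ.+-mono-≤ 0≤r 0≤h) (ℚₚ.+-mono-≤ (ℚₚ.<⇒≤ (ℚₚ.≰⇒> ½≰r)) h≤½) ⟩
  (½ Q.+ ½) Q.* (½ Q.+ ½)    ≤⟨ 1≤x ⟩
  x                          ∎) (ℚₚ.<-irrefl refl)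
  where open ℚₚ.≤-Reasoning

0<√ : ∀ x → (∀ n → 1ℚ Q.≤ seq x n) → 0ℝ < √ x
0<√ x 1≤x = ½ , ℚₚ.positive⁻¹ ½ , N , λ n N≤n →
  let y = seq x n Q.⊔ 0ℚ
      1≤y = ℚₚ.≤-trans (1≤x n) (ℚₚ.p≤p⊔q (seq x n) 0ℚ)
      (0≤r , _ , hi) = rootℚ-spec y n (ℚₚ.p≤q⊔p (seq x n) 0ℚ)
  in subst (Q._≤ rootℚ y n) (sym (ℚₚ.+-identityˡ ½))
       (½≤-root 0≤r (ℚₚ.<⇒≤ (0<mesh n)) (small n N≤n) 1≤y hi)
  where
  M = mesh-small ½ (ℚₚ.positive⁻¹ ½)
  N = proj₁ M
  small = proj₂ M

0<√3 : 0ℝ < √ 3ℝ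
0<√3 = 0<√ 3ℝ λ _ → fromℕ-mono {1} {3} (ℕ.s≤s ℕ.z≤n)

1/√3 : ℝ
1/√3 = recip (√ 3ℝ) 0<√3

ℝ² : Set
ℝ² = ℝ × ℝ

d : ℝ² → ℝ² → ℝ
d (x₁ , y₁) (x₂ , y₂) = √ ((x₁ - x₂) * (x₁ - x₂) + (y₁ - y₂) * (y₁ - y₂))

record Graph : Set₁ where
  field
    V        : Set
    order    : ℕ
    finite   : V ↔ Fin order
    _~_      : Rel V 0ℓ
    ~-sym    : Symmetric _~_
    ~-irrefl : Irreflexive _≡_ _~_
    edge     : ∃[ u ] ∃[ v ] u ~ v

  vertices : List V
  vertices = map (Inverse.from finite) (allFin order)

infixl 6 _⊎ᵍ_

_⊎ᵍ_ : Graph → Graph → Graph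
G ⊎ᵍ H = record
  { V        = G.V ⊎ H.V
  ; order    = G.order ℕ.+ H.order
  ; finite   = ↔-sym +↔⊎ ↔-∘ (G.finite ⊎-↔ H.finite)
  ; _~_      = Pointwise G._~_ H._~_
  ; ~-sym    = ⊎-symmetric G.~-sym H.~-sym
  ; ~-irrefl = λ { refl (inj₁ e) → G.~-irrefl refl e ; refl (inj₂ e) → H.~-irrefl refl e }
  ; edge     = let (u , v , e) = G.edge in inj₁ u , inj₁ v , inj₁ e
  }
  where
  module G = Graph G
  module H = Graph H

module _ (G : Graph) where
  open Graph G

  record Realization : Set where
    field
      r         : V → ℝ²
      separated : ∀ {u v} → u ~ v → 1ℝ ≤ d (r u) (r v)

  -- Starting the maximum at 0 is harmless, because d (r u) (r u) ≈ 0 and V is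
  -- inhabited.
  width : Realization → ℝ
  width R = foldr _⊔_ 0ℝ (map (λ (u , v) → d (r u) (r v)) (cartesianProduct vertices vertices))
    where open Realization R

  -- w = pw(G).  "w is the minimum" is a relation: the existence of an optimal
  -- realization rests on compactness and is not constructive.
  record IsPlaneWidth (w : ℝ) : Set where
    field
      attained : ∃[ R ] width R ≈ w
      minimal  : ∀ R → w ≤ width R

{-# OPTIONS --safe #-}
module Submission where

-- By Jung's theorem, a finite set of points of the plane of diameter w lies in a
-- closed disc of radius w/√3.  Translate optimal realizations of G and H so that
-- both discs are centred at the origin, and superpose them.  Distances inside G
-- and inside H are unchanged, and by the triangle inequality a vertex of G is at
-- distance at most (pw(G) + pw(H))/√3 from a vertex of H.
--
-- An inequality of reals may be proved up to every ε > 0, so it is enough to have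
-- Jung's theorem up to ε, and only for rational points: the points of a
-- realization at one late stage N of their Cauchy sequences (jung-realization).
-- The centre found there is rational and serves for all stages n ≥ N.
--
-- The rational Jung theorem (jung) has a proof by finitely many steps of ascent.
-- To weights wᵢ ≥ 0 of sum 1 on points pᵢ belong a mean and a variance v.
--   * On three points with |pᵢ - pⱼ|² ≤ D the variance is the sum of
--     wᵢ wⱼ |pᵢ - pⱼ|² over i < j, and so 3v ≤ D (3var≤).
--   * If some point q of the set is further than v + ε from the mean, in squared
--     distance, then giving q a small weight increases the variance by at least
--     a constant δ (var-mix, Jung.improve).
--   * This makes a fourth point of positive weight.  Four points of the plane are
--     affinely dependent; moving the weights along a dependence fixes the mean
--     and changes the variance linearly, so in one of the two directions the
--     variance does not decrease, and the first weight to vanish can be dropped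
--     (drop-point).
-- Since the variance never exceeds D/3, the steps stop (bounded-ascent), and then
-- the disc about the mean of squared radius v + ε ≤ D/3 + ε contains all points.

open import Defs
open import Data.Nat as ℕ using (ℕ; zero; suc)
import Data.Nat.Properties as ℕₚ
import Data.Rational as Q
open Q using (ℚ; 0ℚ; 1ℚ; ½)
import Data.Rational.Properties as ℚₚ
open import Algebra.Properties.CommutativeMonoid.Sum ℚₚ.+-0-commutativeMonoid
  using (sum; sum-remove)
open import Data.Fin using (Fin; zero; suc; punchIn)
open import Data.Fin.Patterns using (0F; 1F; 2F; 3F)
open import Data.Fin.Properties using (all?; ¬∀⟶∃¬)
import Data.List as List
open import Data.List.Membership.Propositional using (_∈_)
open import Data.List.Membership.Propositional.Properties
  using (∈-map⁺; ∈-allFin; ∈-cartesianProduct⁺)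
open import Data.List.Relation.Unary.Any using (here; there)
open import Data.Product using (∃-syntax; _×_; _,_; proj₁; proj₂)
open import Data.Sum using (_⊎_; inj₁; inj₂)
open import Data.Sum.Relation.Binary.Pointwise using (inj₁; inj₂)
open import Data.Vec.Functional using (_∷_; [])
open import Function using (_∘_)
open import Function.Bundles using (Inverse)
open import Relation.Nullary using (¬_; yes; no; contradiction)
open import Relation.Binary.PropositionalEquality
  using (_≡_; _≢_; refl; sym; trans; cong; cong₂; subst; module ≡-Reasoning)

-- Inequalities over the rationals

-- An inequality from a nonnegative expression for the difference.
≤-by : ∀ {p q} e → 0ℚ Q.≤ e → q ≡ p Q.+ e → p Q.≤ q
≤-by {p} {q} e 0≤e eq = begin
  p            ≡⟨ ℚₚ.+-identityʳ p ⟨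
  p Q.+ 0ℚ     ≤⟨ ℚₚ.+-monoʳ-≤ p 0≤e ⟩
  p Q.+ e      ≡⟨ eq ⟨
  q            ∎
  where open ℚₚ.≤-Reasoning

≤⇒0≤- : ∀ {p q} → p Q.≤ q → 0ℚ Q.≤ q Q.- p
≤⇒0≤- {p} {q} p≤q = subst (Q._≤ q Q.- p) (ℚₚ.+-inverseʳ p) (ℚₚ.+-monoˡ-≤ (Q.- p) p≤q)

0≤-+ : ∀ {p q} → 0ℚ Q.≤ p → 0ℚ Q.≤ q → 0ℚ Q.≤ p Q.+ q
0≤-+ = ℚₚ.+-mono-≤

0≤-* : ∀ {p q} → 0ℚ Q.≤ p → 0ℚ Q.≤ q → 0ℚ Q.≤ p Q.* q
0≤-* {p} {q} 0≤p 0≤q = subst (Q._≤ p Q.* q) (ℚₚ.*-zeroˡ q) (*-mono 0≤p 0≤q 0≤p ℚₚ.≤-refl)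

0≤-² : ∀ p → 0ℚ Q.≤ p Q.* p
0≤-² p with ℚₚ.≤-total 0ℚ p
... | inj₁ 0≤p = 0≤-* 0≤p 0≤p
... | inj₂ p≤0 = subst (0ℚ Q.≤_) (S.solve 1 (λ p → (S.:- p) S.:* (S.:- p) S.:= p S.:* p) refl p)
                   (0≤-* (ℚₚ.neg-antimono-≤ p≤0) (ℚₚ.neg-antimono-≤ p≤0))

0≤1 : 0ℚ Q.≤ 1ℚ
0≤1 = ℚₚ.<⇒≤ 0<1

²-cancel-≤ : ∀ {p q} → 0ℚ Q.≤ q → p Q.* p Q.≤ q Q.* q → p Q.≤ q
²-cancel-≤ {p} {q} 0≤q p²≤q² with p ℚₚ.≤? q
... | yes p≤q = p≤q
... | no  p≰q = contradiction (begin-strict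
  p Q.* p   ≤⟨ p²≤q² ⟩
  q Q.* q   ≤⟨ *-mono 0≤q 0≤q ℚₚ.≤-refl (ℚₚ.<⇒≤ q<p) ⟩
  q Q.* p   <⟨ ℚₚ.*-monoˡ-<-pos p {{Q.positive (ℚₚ.≤-<-trans 0≤q q<p)}} q<p ⟩
  p Q.* p   ∎) (ℚₚ.<-irrefl refl)
  where
  open ℚₚ.≤-Reasoning
  q<p : q Q.< p
  q<p = ℚₚ.≰⇒> p≰q

-- Points of the rational plane

Point : Set
Point = ℚ × ℚ

infixl 6 _∸ᵖ_

_∸ᵖ_ : Point → Point → Point
(x , y) ∸ᵖ (x′ , y′) = x Q.- x′ , y Q.- y′

-- The squared Euclidean norm, which stays rational.
∥_∥² : Point → ℚ
∥ x , y ∥² = x Q.* x Q.+ y Q.* y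

0≤∥∥² : ∀ p → 0ℚ Q.≤ ∥ p ∥²
0≤∥∥² (x , y) = 0≤-+ (0≤-² x) (0≤-² y)

∥∥²-flip : ∀ p q → ∥ p ∸ᵖ q ∥² ≡ ∥ q ∸ᵖ p ∥²
∥∥²-flip (a , b) (c , e) = S.solve 4 (λ a b c e →
  (a S.:- c) S.:* (a S.:- c) S.:+ (b S.:- e) S.:* (b S.:- e) S.:=
  (c S.:- a) S.:* (c S.:- a) S.:+ (e S.:- b) S.:* (e S.:- b)) refl a b c e

-- The triangle inequality for norms known through upper bounds α and β, proved by
-- Cauchy-Schwarz: |p|²|q|² - (p · q)² is the square of the cross product.
∥∥²-triangle : ∀ {p q α β} → 0ℚ Q.≤ α → 0ℚ Q.≤ β →
  ∥ p ∥² Q.≤ α Q.* α → ∥ q ∥² Q.≤ β Q.* β → ∥ p ∸ᵖ q ∥² Q.≤ (α Q.+ β) Q.* (α Q.+ β)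
∥∥²-triangle {p@(a , b)} {q@(c , e)} {α} {β} 0≤α 0≤β p≤ q≤ = begin
  ∥ p ∸ᵖ q ∥²
    ≡⟨ S.solve 4 (λ a b c e → (a S.:- c) S.:* (a S.:- c) S.:+ (b S.:- e) S.:* (b S.:- e) S.:=
         ((a S.:* a S.:+ b S.:* b) S.:+ (c S.:* c S.:+ e S.:* e)) S.:+
         ((S.:- (a S.:* c S.:+ b S.:* e)) S.:+ (S.:- (a S.:* c S.:+ b S.:* e)))) refl a b c e ⟩
  (∥ p ∥² Q.+ ∥ q ∥²) Q.+ (dot Q.+ dot)
    ≤⟨ ℚₚ.+-mono-≤ (ℚₚ.+-mono-≤ p≤ q≤) (ℚₚ.+-mono-≤ dot≤ dot≤) ⟩
  (α Q.* α Q.+ β Q.* β) Q.+ (α Q.* β Q.+ α Q.* β)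
    ≡⟨ S.solve 2 (λ α β → (α S.:* α S.:+ β S.:* β) S.:+ (α S.:* β S.:+ α S.:* β) S.:=
         (α S.:+ β) S.:* (α S.:+ β)) refl α β ⟩
  (α Q.+ β) Q.* (α Q.+ β) ∎
  where
  open ℚₚ.≤-Reasoning
  dot cross : ℚ
  dot   = Q.- (a Q.* c Q.+ b Q.* e)
  cross = a Q.* e Q.- b Q.* c
  dot≤ : dot Q.≤ α Q.* β
  dot≤ = ²-cancel-≤ (0≤-* 0≤α 0≤β) (begin
    dot Q.* dot
      ≤⟨ ≤-by (cross Q.* cross) (0≤-² cross)
           (S.solve 4 (λ a b c e → (a S.:* a S.:+ b S.:* b) S.:* (c S.:* c S.:+ e S.:* e) S.:=
              (S.:- (a S.:* c S.:+ b S.:* e)) S.:* (S.:- (a S.:* c S.:+ b S.:* e)) S.:+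
              (a S.:* e S.:- b S.:* c) S.:* (a S.:* e S.:- b S.:* c)) refl a b c e) ⟩
    ∥ p ∥² Q.* ∥ q ∥²
      ≤⟨ *-mono (0≤-² α) (0≤∥∥² q) p≤ q≤ ⟩
    (α Q.* α) Q.* (β Q.* β)
      ≡⟨ S.solve 2 (λ α β → (α S.:* α) S.:* (β S.:* β) S.:= (α S.:* β) S.:* (α S.:* β)) refl α β ⟩
    (α Q.* β) Q.* (α Q.* β) ∎)

-- Weighted sums

-- The sum of wᵢ φᵢ over i: the expectation of φ when w is a probability weight.
E : ∀ {n} → (Fin n → ℚ) → (Fin n → ℚ) → ℚ
E w φ = sum (λ i → w i Q.* φ i)

E-axpy : ∀ {n} (w μ φ : Fin n → ℚ) s → E (λ i → w i Q.+ s Q.* μ i) φ ≡ E w φ Q.+ s Q.* E μ φ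
E-axpy {zero}  w μ φ s = S.solve 1 (λ s → S.con 0ℚ S.:= S.con 0ℚ S.:+ s S.:* S.con 0ℚ) refl s
E-axpy {suc n} w μ φ s = trans
  (cong ((w 0F Q.+ s Q.* μ 0F) Q.* φ 0F Q.+_) (E-axpy (w ∘ suc) (μ ∘ suc) (φ ∘ suc) s))
  (S.solve 6 (λ w μ φ s e f → (w S.:+ s S.:* μ) S.:* φ S.:+ (e S.:+ s S.:* f) S.:=
     (w S.:* φ S.:+ e) S.:+ s S.:* (μ S.:* φ S.:+ f)) refl
     (w 0F) (μ 0F) (φ 0F) s (E (w ∘ suc) (φ ∘ suc)) (E (μ ∘ suc) (φ ∘ suc)))

E-scale : ∀ {n} (w φ : Fin n → ℚ) s → E (λ i → s Q.* w i) φ ≡ s Q.* E w φ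
E-scale {zero}  w φ s = sym (ℚₚ.*-zeroʳ s)
E-scale {suc n} w φ s = trans
  (cong ((s Q.* w 0F) Q.* φ 0F Q.+_) (E-scale (w ∘ suc) (φ ∘ suc) s))
  (S.solve 4 (λ w φ s e → (s S.:* w) S.:* φ S.:+ s S.:* e S.:= s S.:* (w S.:* φ S.:+ e)) refl
     (w 0F) (φ 0F) s (E (w ∘ suc) (φ ∘ suc)))

E-nonNeg : ∀ {n} (w φ : Fin n → ℚ) → (∀ i → 0ℚ Q.≤ w i) → (∀ i → 0ℚ Q.≤ φ i) → 0ℚ Q.≤ E w φ
E-nonNeg {zero}  w φ 0≤w 0≤φ = ℚₚ.≤-refl
E-nonNeg {suc n} w φ 0≤w 0≤φ =
  0≤-+ (0≤-* (0≤w 0F) (0≤φ 0F)) (E-nonNeg (w ∘ suc) (φ ∘ suc) (0≤w ∘ suc) (0≤φ ∘ suc))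

-- E w one is the total weight.
one : ∀ {n} → Fin n → ℚ
one _ = 1ℚ

E-upper : ∀ {n} (w φ : Fin n → ℚ) {B} → (∀ i → 0ℚ Q.≤ w i) → (∀ i → φ i Q.≤ B) →
  E w φ Q.≤ E w one Q.* B
E-upper {zero}  w φ {B} 0≤w φ≤ = ℚₚ.≤-reflexive (sym (ℚₚ.*-zeroˡ B))
E-upper {suc n} w φ {B} 0≤w φ≤ = begin
  w 0F Q.* φ 0F Q.+ E w′ φ′
    ≤⟨ ℚₚ.+-mono-≤ (ℚₚ.*-monoˡ-≤-nonNeg (w 0F) {{Q.nonNegative (0≤w 0F)}} (φ≤ 0F))
                   (E-upper w′ φ′ (0≤w ∘ suc) (φ≤ ∘ suc)) ⟩
  w 0F Q.* B Q.+ E w′ one Q.* B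
    ≡⟨ S.solve 3 (λ w e B → w S.:* B S.:+ e S.:* B S.:= (w S.:* S.con 1ℚ S.:+ e) S.:* B) refl
         (w 0F) (E w′ one) B ⟩
  (w 0F Q.* 1ℚ Q.+ E w′ one) Q.* B ∎
  where
  open ℚₚ.≤-Reasoning
  w′ φ′ : Fin n → ℚ
  w′ = w ∘ suc
  φ′ = φ ∘ suc

E-remove : ∀ {n} (w φ : Fin (suc n) → ℚ) i → w i ≡ 0ℚ → E w φ ≡ E (w ∘ punchIn i) (φ ∘ punchIn i)
E-remove w φ i wᵢ≡0 = begin
  E w φ                        ≡⟨ sum-remove {i = i} (λ j → w j Q.* φ j) ⟩
  w i Q.* φ i Q.+ rest         ≡⟨ cong (λ z → z Q.* φ i Q.+ rest) wᵢ≡0 ⟩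
  0ℚ Q.* φ i Q.+ rest          ≡⟨ cong (Q._+ rest) (ℚₚ.*-zeroˡ (φ i)) ⟩
  0ℚ Q.+ rest                  ≡⟨ ℚₚ.+-identityˡ rest ⟩
  rest                         ∎
  where
  open ≡-Reasoning
  rest : ℚ
  rest = E (w ∘ punchIn i) (φ ∘ punchIn i)

-- Mean and variance of a weighted family of points

-- Nonnegative weights of sum 1.
record IsWeight {n} (w : Fin n → ℚ) : Set where
  field
    nonNeg : ∀ i → 0ℚ Q.≤ w i
    total  : E w one ≡ 1ℚ
open IsWeight

module _ {n} (w : Fin n → ℚ) (p : Fin n → Point) where

  mean : Point
  mean = E w (proj₁ ∘ p) , E w (proj₂ ∘ p)

  -- The second moment.
  second : ℚ
  second = E w (∥_∥² ∘ p)

  var : ℚ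
  var = second Q.- ∥ mean ∥²

private
  E-dist² : ∀ {n} (w : Fin n → ℚ) p a b → E w (λ i → ∥ (a , b) ∸ᵖ p i ∥²) ≡
    E w one Q.* ∥ a , b ∥² Q.- ((a Q.+ a) Q.* proj₁ (mean w p) Q.+ (b Q.+ b) Q.* proj₂ (mean w p))
      Q.+ second w p
  E-dist² {zero}  w p a b = S.solve 2 (λ a b → S.con 0ℚ S.:=
    S.con 0ℚ S.:* (a S.:* a S.:+ b S.:* b) S.:-
      ((a S.:+ a) S.:* S.con 0ℚ S.:+ (b S.:+ b) S.:* S.con 0ℚ) S.:+ S.con 0ℚ) refl a b
  E-dist² {suc n} w p a b = trans
    (cong (w 0F Q.* ∥ (a , b) ∸ᵖ p 0F ∥² Q.+_) (E-dist² (w ∘ suc) (p ∘ suc) a b))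
    (S.solve 9 (λ w x y a b m mx my ms →
       w S.:* ((a S.:- x) S.:* (a S.:- x) S.:+ (b S.:- y) S.:* (b S.:- y)) S.:+
         (m S.:* (a S.:* a S.:+ b S.:* b) S.:-
           ((a S.:+ a) S.:* mx S.:+ (b S.:+ b) S.:* my) S.:+ ms) S.:=
       (w S.:* S.con 1ℚ S.:+ m) S.:* (a S.:* a S.:+ b S.:* b) S.:-
         ((a S.:+ a) S.:* (w S.:* x S.:+ mx) S.:+ (b S.:+ b) S.:* (w S.:* y S.:+ my)) S.:+
         (w S.:* (x S.:* x S.:+ y S.:* y) S.:+ ms))
       refl (w 0F) (proj₁ (p 0F)) (proj₂ (p 0F)) a b
       (E (w ∘ suc) one) (proj₁ (mean (w ∘ suc) (p ∘ suc))) (proj₂ (mean (w ∘ suc) (p ∘ suc)))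
       (second (w ∘ suc) (p ∘ suc)))

-- The parallel axis theorem: the mean squared distance to q is the squared distance
-- from q to the mean plus the variance.
parallel-axis : ∀ {n} (w : Fin n → ℚ) p q → E w one ≡ 1ℚ →
  E w (λ i → ∥ q ∸ᵖ p i ∥²) ≡ ∥ q ∸ᵖ mean w p ∥² Q.+ var w p
parallel-axis w p (a , b) tot = trans (E-dist² w p a b) (trans
  (cong (λ z → z Q.* ∥ a , b ∥² Q.-
    ((a Q.+ a) Q.* proj₁ (mean w p) Q.+ (b Q.+ b) Q.* proj₂ (mean w p)) Q.+ second w p) tot)
  (S.solve 5 (λ a b x y s →
     S.con 1ℚ S.:* (a S.:* a S.:+ b S.:* b) S.:- ((a S.:+ a) S.:* x S.:+ (b S.:+ b) S.:* y) S.:+ s S.:=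
     ((a S.:- x) S.:* (a S.:- x) S.:+ (b S.:- y) S.:* (b S.:- y)) S.:+
       (s S.:- (x S.:* x S.:+ y S.:* y)))
     refl a b (proj₁ (mean w p)) (proj₂ (mean w p)) (second w p)))

0≤var : ∀ {n} (w : Fin n → ℚ) p → IsWeight w → 0ℚ Q.≤ var w p
0≤var w p W = subst (0ℚ Q.≤_) eq (E-nonNeg w _ (nonNeg W) (λ i → 0≤∥∥² (mean w p ∸ᵖ p i)))
  where
  eq : E w (λ i → ∥ mean w p ∸ᵖ p i ∥²) ≡ var w p
  eq = trans (parallel-axis w p (mean w p) (total W))
    (S.solve 3 (λ x y v → ((x S.:- x) S.:* (x S.:- x) S.:+ (y S.:- y) S.:* (y S.:- y)) S.:+ v S.:= v)
      refl (proj₁ (mean w p)) (proj₂ (mean w p)) (var w p))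

dist-mean≤ : ∀ {n} (w : Fin n → ℚ) p q {D} → IsWeight w → (∀ i → ∥ q ∸ᵖ p i ∥² Q.≤ D) →
  ∥ q ∸ᵖ mean w p ∥² Q.≤ D
dist-mean≤ w p q {D} W ≤D = begin
  ∥ q ∸ᵖ mean w p ∥²                ≤⟨ ≤-by (var w p) (0≤var w p W) (parallel-axis w p q (total W)) ⟩
  E w (λ i → ∥ q ∸ᵖ p i ∥²)         ≤⟨ E-upper w _ (nonNeg W) ≤D ⟩
  E w one Q.* D                     ≡⟨ cong (Q._* D) (total W) ⟩
  1ℚ Q.* D                          ≡⟨ ℚₚ.*-identityˡ D ⟩
  D                                 ∎
  where open ℚₚ.≤-Reasoning

3ℚ : ℚ
3ℚ = 1ℚ Q.+ 1ℚ Q.+ 1ℚ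

-- The variance is the sum of wᵢ wⱼ |pᵢ - pⱼ|² over i < j, and the sum of the wᵢ wⱼ
-- is at most 1/3.
3var≤ : ∀ (w : Fin 3 → ℚ) p {D} → IsWeight w → 0ℚ Q.≤ D →
  (∀ i j → ∥ p i ∸ᵖ p j ∥² Q.≤ D) → 3ℚ Q.* var w p Q.≤ D
3var≤ w p {D} W 0≤D ≤D = begin
  3ℚ Q.* var w p
    ≡⟨ cong (3ℚ Q.*_) pairs ⟩
  3ℚ Q.* ((a Q.* b) Q.* ∥ p 0F ∸ᵖ p 1F ∥² Q.+ (a Q.* c) Q.* ∥ p 0F ∸ᵖ p 2F ∥²
      Q.+ (b Q.* c) Q.* ∥ p 1F ∸ᵖ p 2F ∥²)
    ≤⟨ ℚₚ.*-monoˡ-≤-nonNeg 3ℚ (ℚₚ.+-mono-≤ (ℚₚ.+-mono-≤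
         (bnd 0F 1F) (bnd 0F 2F)) (bnd 1F 2F)) ⟩
  3ℚ Q.* ((a Q.* b) Q.* D Q.+ (a Q.* c) Q.* D Q.+ (b Q.* c) Q.* D)
    ≤⟨ ≤-by (½ Q.* D Q.* ((a Q.- b) Q.* (a Q.- b) Q.+ (a Q.- c) Q.* (a Q.- c) Q.+ (b Q.- c) Q.* (b Q.- c)))
         (0≤-* (0≤-* (ℚₚ.<⇒≤ (ℚₚ.positive⁻¹ ½)) 0≤D)
           (0≤-+ (0≤-+ (0≤-² (a Q.- b)) (0≤-² (a Q.- c))) (0≤-² (b Q.- c))))
         (S.solve 4 (λ a b c D →
            let s = a S.:* S.con 1ℚ S.:+ (b S.:* S.con 1ℚ S.:+ (c S.:* S.con 1ℚ S.:+ S.con 0ℚ)) in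
            s S.:* s S.:* D S.:=
            S.con 3ℚ S.:* ((a S.:* b) S.:* D S.:+ (a S.:* c) S.:* D S.:+ (b S.:* c) S.:* D) S.:+
            S.con ½ S.:* D S.:* ((a S.:- b) S.:* (a S.:- b) S.:+ (a S.:- c) S.:* (a S.:- c)
              S.:+ (b S.:- c) S.:* (b S.:- c)))
            refl a b c D) ⟩
  E w one Q.* E w one Q.* D
    ≡⟨ cong (λ z → z Q.* z Q.* D) (total W) ⟩
  1ℚ Q.* 1ℚ Q.* D
    ≡⟨ ℚₚ.*-identityˡ D ⟩
  D ∎
  where
  open ℚₚ.≤-Reasoning
  a b c : ℚ
  a = w 0F
  b = w 1F
  c = w 2F
  X Y : Fin 3 → ℚ
  X = proj₁ ∘ p
  Y = proj₂ ∘ p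
  bnd : ∀ i j → (w i Q.* w j) Q.* ∥ p i ∸ᵖ p j ∥² Q.≤ (w i Q.* w j) Q.* D
  bnd i j = ℚₚ.*-monoˡ-≤-nonNeg (w i Q.* w j) {{Q.nonNegative (0≤-* (nonNeg W i) (nonNeg W j))}} (≤D i j)
  Δ : (Fin 3 → ℚ) → Fin 3 → Fin 3 → ℚ
  Δ Z i j = (Z i Q.- Z j) Q.* (Z i Q.- Z j)
  -- The variance of a single coordinate.
  pairs₁ : ∀ (Z : Fin 3 → ℚ) → E w one Q.* E w (λ i → Z i Q.* Z i) Q.- E w Z Q.* E w Z ≡
    (a Q.* b) Q.* Δ Z 0F 1F Q.+ (a Q.* c) Q.* Δ Z 0F 2F Q.+ (b Q.* c) Q.* Δ Z 1F 2F
  pairs₁ Z = S.solve 6 (λ a b c x y z →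
    let s  = a S.:* S.con 1ℚ S.:+ (b S.:* S.con 1ℚ S.:+ (c S.:* S.con 1ℚ S.:+ S.con 0ℚ))
        m  = a S.:* x S.:+ (b S.:* y S.:+ (c S.:* z S.:+ S.con 0ℚ))
        m₂ = a S.:* (x S.:* x) S.:+ (b S.:* (y S.:* y) S.:+ (c S.:* (z S.:* z) S.:+ S.con 0ℚ))
    in s S.:* m₂ S.:- m S.:* m S.:=
       (a S.:* b) S.:* ((x S.:- y) S.:* (x S.:- y)) S.:+ (a S.:* c) S.:* ((x S.:- z) S.:* (x S.:- z))
         S.:+ (b S.:* c) S.:* ((y S.:- z) S.:* (y S.:- z)))
    refl a b c (Z 0F) (Z 1F) (Z 2F)
  E-add : second w p ≡ E w (λ i → X i Q.* X i) Q.+ E w (λ i → Y i Q.* Y i)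
  E-add = S.solve 9 (λ a b c p q r s t u →
    a S.:* (p S.:+ s) S.:+ (b S.:* (q S.:+ t) S.:+ (c S.:* (r S.:+ u) S.:+ S.con 0ℚ)) S.:=
    (a S.:* p S.:+ (b S.:* q S.:+ (c S.:* r S.:+ S.con 0ℚ))) S.:+
    (a S.:* s S.:+ (b S.:* t S.:+ (c S.:* u S.:+ S.con 0ℚ))))
    refl a b c (X 0F Q.* X 0F) (X 1F Q.* X 1F) (X 2F Q.* X 2F) (Y 0F Q.* Y 0F) (Y 1F Q.* Y 1F) (Y 2F Q.* Y 2F)
  pairs : var w p ≡
    (a Q.* b) Q.* ∥ p 0F ∸ᵖ p 1F ∥² Q.+ (a Q.* c) Q.* ∥ p 0F ∸ᵖ p 2F ∥²
      Q.+ (b Q.* c) Q.* ∥ p 1F ∸ᵖ p 2F ∥²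
  pairs = let s = E w one; mx = E w X; my = E w Y
              sx = E w (λ i → X i Q.* X i); sy = E w (λ i → Y i Q.* Y i) in begin-equality
    second w p Q.- ∥ mean w p ∥²
      ≡⟨ cong (Q._- ∥ mean w p ∥²) E-add ⟩
    (sx Q.+ sy) Q.- (mx Q.* mx Q.+ my Q.* my)
      ≡⟨ S.solve 4 (λ sx sy mx my → (sx S.:+ sy) S.:- (mx S.:* mx S.:+ my S.:* my) S.:=
           (S.con 1ℚ S.:* sx S.:- mx S.:* mx) S.:+ (S.con 1ℚ S.:* sy S.:- my S.:* my)) refl sx sy mx my ⟩
    (1ℚ Q.* sx Q.- mx Q.* mx) Q.+ (1ℚ Q.* sy Q.- my Q.* my)
      ≡⟨ cong (λ z → (z Q.* sx Q.- mx Q.* mx) Q.+ (z Q.* sy Q.- my Q.* my)) (total W) ⟨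
    (s Q.* sx Q.- mx Q.* mx) Q.+ (s Q.* sy Q.- my Q.* my)
      ≡⟨ cong₂ Q._+_ (pairs₁ X) (pairs₁ Y) ⟩
    _ ≡⟨ S.solve 9 (λ u v t p q r x y z →
           (u S.:* p S.:+ v S.:* q S.:+ t S.:* r) S.:+ (u S.:* x S.:+ v S.:* y S.:+ t S.:* z) S.:=
           u S.:* (p S.:+ x) S.:+ v S.:* (q S.:+ y) S.:+ t S.:* (r S.:+ z)) refl
           (a Q.* b) (a Q.* c) (b Q.* c) (Δ X 0F 1F) (Δ X 0F 2F) (Δ X 1F 2F)
           (Δ Y 0F 1F) (Δ Y 0F 2F) (Δ Y 1F 2F) ⟩
    (a Q.* b) Q.* ∥ p 0F ∸ᵖ p 1F ∥² Q.+ (a Q.* c) Q.* ∥ p 0F ∸ᵖ p 2F ∥² Q.+ (b Q.* c) Q.* ∥ p 1F ∸ᵖ p 2F ∥² ∎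

-- Carathéodory reduction

-- Moving from w ≥ 0 in a direction μ that has a negative entry, some coordinate is
-- the first to vanish.  The induction compares the time s₀ at which coordinate 0
-- vanishes with the first such time s for the other coordinates.
ratio-test : ∀ {n} (w μ : Fin n → ℚ) → (∀ i → 0ℚ Q.≤ w i) →
  (∀ i → 0ℚ Q.≤ μ i) ⊎
  (∃[ s ] 0ℚ Q.≤ s × (∀ i → 0ℚ Q.≤ w i Q.+ s Q.* μ i) × ∃[ i ] w i Q.+ s Q.* μ i ≡ 0ℚ)
ratio-test {zero}  w μ 0≤w = inj₁ λ ()
ratio-test {suc n} w μ 0≤w with 0ℚ ℚₚ.≤? μ 0F | ratio-test (w ∘ suc) (μ ∘ suc) (0≤w ∘ suc)
... | yes 0≤μ₀ | inj₁ 0≤μ = inj₁ λ { zero → 0≤μ₀ ; (suc i) → 0≤μ i }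
... | yes 0≤μ₀ | inj₂ (s , 0≤s , ok , i , hit) =
  inj₂ (s , 0≤s , (λ { zero → 0≤-+ (0≤w 0F) (0≤-* 0≤s 0≤μ₀) ; (suc i) → ok i }) , suc i , hit)
... | no 0≰μ₀ | tail = first tail
  where
  m s₀ : ℚ
  m = Q.- μ 0F
  0<m : 0ℚ Q.< m
  0<m = ℚₚ.neg-antimono-< (ℚₚ.≰⇒> 0≰μ₀)
  s₀ = w 0F Q.* recipℚ m 0<m
  0≤s₀ : 0ℚ Q.≤ s₀
  0≤s₀ = 0≤-* (0≤w 0F) (ℚₚ.<⇒≤ (recipℚ-pos m 0<m))
  hit₀ : w 0F Q.+ s₀ Q.* μ 0F ≡ 0ℚ
  hit₀ = begin
    w 0F Q.+ s₀ Q.* μ 0F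
      ≡⟨ S.solve 3 (λ w r μ → w S.:+ (w S.:* r) S.:* μ S.:= w S.:* (S.con 1ℚ S.:- (S.:- μ) S.:* r)) refl
           (w 0F) (recipℚ m 0<m) (μ 0F) ⟩
    w 0F Q.* (1ℚ Q.- m Q.* recipℚ m 0<m)   ≡⟨ cong (λ z → w 0F Q.* (1ℚ Q.- z)) (recipℚ-inv m 0<m) ⟩
    w 0F Q.* (1ℚ Q.- 1ℚ)                   ≡⟨ ℚₚ.*-zeroʳ (w 0F) ⟩
    0ℚ                                     ∎
    where open ≡-Reasoning
  -- A coordinate that is nonnegative at time t was so at all times before.
  earlier : ∀ {s t} i → 0ℚ Q.≤ s → s Q.≤ t → 0ℚ Q.≤ w i Q.+ t Q.* μ i → 0ℚ Q.≤ w i Q.+ s Q.* μ i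
  earlier {s} {t} i 0≤s s≤t ok with 0ℚ ℚₚ.≤? μ i
  ... | yes 0≤μᵢ = 0≤-+ (0≤w i) (0≤-* 0≤s 0≤μᵢ)
  ... | no  0≰μᵢ = ℚₚ.≤-trans ok (ℚₚ.+-monoʳ-≤ (w i)
    (ℚₚ.*-monoʳ-≤-nonPos (μ i) {{Q.nonPositive (ℚₚ.<⇒≤ (ℚₚ.≰⇒> 0≰μᵢ))}} s≤t))
  first : _ → _
  first (inj₁ 0≤μ) = inj₂ (s₀ , 0≤s₀ ,
    (λ { zero → ℚₚ.≤-reflexive (sym hit₀) ; (suc i) → 0≤-+ (0≤w (suc i)) (0≤-* 0≤s₀ (0≤μ i)) }) , 0F , hit₀)
  first (inj₂ (s , 0≤s , ok , i , hit)) with ℚₚ.≤-total s₀ s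
  ... | inj₁ s₀≤s = inj₂ (s₀ , 0≤s₀ ,
    (λ { zero → ℚₚ.≤-reflexive (sym hit₀) ; (suc i) → earlier (suc i) 0≤s₀ s₀≤s (ok i) }) , 0F , hit₀)
  ... | inj₂ s≤s₀ = inj₂ (s , 0≤s ,
    (λ { zero → earlier 0F 0≤s s≤s₀ (ℚₚ.≤-reflexive (sym hit₀)) ; (suc i) → ok i }) , suc i , hit)

≤E-one : ∀ {n} (μ : Fin n → ℚ) → (∀ i → 0ℚ Q.≤ μ i) → ∀ i → μ i Q.≤ E μ one
≤E-one {suc n} μ 0≤μ zero = ≤-by (E (μ ∘ suc) one) (E-nonNeg _ _ (0≤μ ∘ suc) (λ _ → 0≤1))
  (cong (Q._+ E (μ ∘ suc) one) (ℚₚ.*-identityʳ (μ 0F)))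
≤E-one {suc n} μ 0≤μ (suc i) = ℚₚ.≤-trans (≤E-one (μ ∘ suc) (0≤μ ∘ suc) i)
  (≤-by (μ 0F) (0≤μ 0F) (S.solve 2 (λ a e → a S.:* S.con 1ℚ S.:+ e S.:= e S.:+ a) refl (μ 0F) (E (μ ∘ suc) one)))

-- A nontrivial affine dependence between points: total weight 0 and mean 0.
record Dependence {n} (p : Fin n → Point) (μ : Fin n → ℚ) : Set where
  field
    total₀   : E μ one ≡ 0ℚ
    mean₀    : mean μ p ≡ (0ℚ , 0ℚ)
    nonzero  : ∃[ i ] μ i ≢ 0ℚ
open Dependence

-- Weights of total 0 on four points, given by their values on the last three.
balance : ℚ → ℚ → ℚ → Fin 4 → ℚ
balance a b c = Q.- (a Q.+ b Q.+ c) ∷ a ∷ b ∷ c ∷ []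

E-balance : ∀ a b c (φ : Fin 4 → ℚ) → E (balance a b c) φ ≡
  a Q.* (φ 1F Q.- φ 0F) Q.+ b Q.* (φ 2F Q.- φ 0F) Q.+ c Q.* (φ 3F Q.- φ 0F)
E-balance a b c φ = S.solve 7 (λ a b c x y z t →
  S.:- (a S.:+ b S.:+ c) S.:* x S.:+ (a S.:* y S.:+ (b S.:* z S.:+ (c S.:* t S.:+ S.con 0ℚ))) S.:=
  a S.:* (y S.:- x) S.:+ b S.:* (z S.:- x) S.:+ c S.:* (t S.:- x)) refl
  a b c (φ 0F) (φ 1F) (φ 2F) (φ 3F)

E-balance-one : ∀ a b c → E (balance a b c) one ≡ 0ℚ
E-balance-one a b c = trans (E-balance a b c one)
  (S.solve 3 (λ a b c → let o = S.con 0ℚ in a S.:* o S.:+ b S.:* o S.:+ c S.:* o S.:= o) refl a b c)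

-- In the frame with origin p 0F, the other three points u, v, w satisfy
-- (v × w) u - (u × w) v + (u × v) w = 0, a nontrivial relation if u × v is not 0.
-- Otherwise u and v are parallel: a coordinate of u that is not 0 gives a relation
-- between u and v, and if u = 0 then u itself is one.
dependence : ∀ (p : Fin 4 → Point) → ∃[ μ ] Dependence p μ
dependence p = dep
  where
  ux = proj₁ (p 1F) Q.- proj₁ (p 0F) ; uy = proj₂ (p 1F) Q.- proj₂ (p 0F)
  vx = proj₁ (p 2F) Q.- proj₁ (p 0F) ; vy = proj₂ (p 2F) Q.- proj₂ (p 0F)
  wx = proj₁ (p 3F) Q.- proj₁ (p 0F) ; wy = proj₂ (p 3F) Q.- proj₂ (p 0F)
  by : ∀ a b c → a Q.* ux Q.+ b Q.* vx Q.+ c Q.* wx ≡ 0ℚ → a Q.* uy Q.+ b Q.* vy Q.+ c Q.* wy ≡ 0ℚ →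
    ∃[ i ] balance a b c i ≢ 0ℚ → ∃[ μ ] Dependence p μ
  by a b c x≡ y≡ ≢0 = balance a b c , record
    { total₀  = E-balance-one a b c
    ; mean₀   = cong₂ _,_ (trans (E-balance a b c (proj₁ ∘ p)) x≡) (trans (E-balance a b c (proj₂ ∘ p)) y≡)
    ; nonzero = ≢0 }
  dep : ∃[ μ ] Dependence p μ
  dep with ux Q.* vy Q.- uy Q.* vx ℚₚ.≟ 0ℚ | ux ℚₚ.≟ 0ℚ | uy ℚₚ.≟ 0ℚ
  ... | no ≢0 | _ | _ =
    by (vx Q.* wy Q.- vy Q.* wx) (uy Q.* wx Q.- ux Q.* wy) (ux Q.* vy Q.- uy Q.* vx)
      (S.solve 6 (λ a b c e f g → (c S.:* g S.:- e S.:* f) S.:* a S.:+ (b S.:* f S.:- a S.:* g) S.:* c S.:+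
         (a S.:* e S.:- b S.:* c) S.:* f S.:= S.con 0ℚ) refl ux uy vx vy wx wy)
      (S.solve 6 (λ a b c e f g → (c S.:* g S.:- e S.:* f) S.:* b S.:+ (b S.:* f S.:- a S.:* g) S.:* e S.:+
         (a S.:* e S.:- b S.:* c) S.:* g S.:= S.con 0ℚ) refl ux uy vx vy wx wy)
      (3F , ≢0)
  ... | yes ≡0 | no ≢0 | _ = by (Q.- vx) ux 0ℚ
      (S.solve 3 (λ a c f → (S.:- c) S.:* a S.:+ a S.:* c S.:+ S.con 0ℚ S.:* f S.:= S.con 0ℚ) refl ux vx wx)
      (trans (S.solve 5 (λ a b c e g → (S.:- c) S.:* b S.:+ a S.:* e S.:+ S.con 0ℚ S.:* g S.:=
                a S.:* e S.:- b S.:* c) refl ux uy vx vy wy) ≡0)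
      (2F , ≢0)
  ... | yes ≡0 | yes _ | no ≢0 = by vy (Q.- uy) 0ℚ
      (trans (S.solve 5 (λ a b c e f → e S.:* a S.:+ (S.:- b) S.:* c S.:+ S.con 0ℚ S.:* f S.:=
                a S.:* e S.:- b S.:* c) refl ux uy vx vy wx) ≡0)
      (S.solve 3 (λ b e g → e S.:* b S.:+ (S.:- b) S.:* e S.:+ S.con 0ℚ S.:* g S.:= S.con 0ℚ) refl uy vy wy)
      (2F , λ eq → ≢0 (trans (S.solve 1 (λ b → b S.:= S.:- (S.:- b)) refl uy) (cong Q.-_ eq)))
  ... | yes _ | yes ux≡0 | yes uy≡0 = by 1ℚ 0ℚ 0ℚ (only ux vx wx ux≡0) (only uy vy wy uy≡0) (1F , λ ())
    where
    only : ∀ a b c → a ≡ 0ℚ → 1ℚ Q.* a Q.+ 0ℚ Q.* b Q.+ 0ℚ Q.* c ≡ 0ℚ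
    only a b c = trans (S.solve 3 (λ a b c →
      S.con 1ℚ S.:* a S.:+ S.con 0ℚ S.:* b S.:+ S.con 0ℚ S.:* c S.:= a) refl a b c)

E-neg : ∀ {n} (μ φ : Fin n → ℚ) → E (Q.-_ ∘ μ) φ ≡ Q.- E μ φ
E-neg {zero}  μ φ = refl
E-neg {suc n} μ φ = trans (cong ((Q.- μ 0F) Q.* φ 0F Q.+_) (E-neg (μ ∘ suc) (φ ∘ suc)))
  (S.solve 3 (λ m f e → (S.:- m) S.:* f S.:+ (S.:- e) S.:= S.:- (m S.:* f S.:+ e)) refl
     (μ 0F) (φ 0F) (E (μ ∘ suc) (φ ∘ suc)))

-- One of the directions μ and -μ does not decrease the second moment.
ascent : ∀ {n} (p : Fin n → Point) → ∃[ μ ] Dependence p μ → ∃[ μ ] Dependence p μ × 0ℚ Q.≤ second μ p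
ascent p (μ , dep) with ℚₚ.≤-total 0ℚ (second μ p)
... | inj₁ 0≤ = μ , dep , 0≤
... | inj₂ ≤0 = Q.-_ ∘ μ , record
  { total₀  = neg₀ (total₀ dep)
  ; mean₀   = cong₂ _,_ (neg₀ (cong proj₁ (mean₀ dep))) (neg₀ (cong proj₂ (mean₀ dep)))
  ; nonzero = let (i , ≢0) = nonzero dep in
              i , λ eq → ≢0 (trans (S.solve 1 (λ m → m S.:= S.:- (S.:- m)) refl (μ i)) (cong Q.-_ eq))
  } , subst (0ℚ Q.≤_) (sym (E-neg μ (∥_∥² ∘ p))) (ℚₚ.neg-antimono-≤ ≤0)
  where
  neg₀ : ∀ {φ} → E μ φ ≡ 0ℚ → E (Q.-_ ∘ μ) φ ≡ 0ℚ
  neg₀ {φ} eq = trans (E-neg μ φ) (cong Q.-_ eq)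

-- Four weighted points of the plane can be replaced by three of them without
-- decreasing the variance; the mean stays the same.
drop-point : ∀ (w : Fin 4 → ℚ) p → IsWeight w →
  ∃[ i ] ∃[ w′ ] IsWeight w′ × var w p Q.≤ var w′ (p ∘ punchIn i)
drop-point w p W with ascent p (dependence p)
... | μ , dep , 0≤s₂ with ratio-test w μ (nonNeg W)
-- Nonnegative weights of total 0 all vanish, so μ has a negative entry.
... | inj₁ 0≤μ = contradiction μₖ≡0 (proj₂ (nonzero dep))
  where
  k : Fin 4
  k = proj₁ (nonzero dep)
  μₖ≡0 : μ k ≡ 0ℚ
  μₖ≡0 = ℚₚ.≤-antisym (subst (μ k Q.≤_) (total₀ dep) (≤E-one μ 0≤μ k)) (0≤μ k)
... | inj₂ (s , 0≤s , ok , i , hit) = i , w′ , record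
  { nonNeg = ok ∘ punchIn i
  ; total  = trans (keep one (total₀ dep)) (total W)
  } , (begin
    second w p Q.- ∥ mean w p ∥²
      ≤⟨ ℚₚ.+-monoˡ-≤ (Q.- ∥ mean w p ∥²) {second w p} {second w′ p′}
           (≤-by {second w p} {second w′ p′} (s Q.* second μ p) (0≤-* 0≤s 0≤s₂) (moved (∥_∥² ∘ p))) ⟩
    second w′ p′ Q.- ∥ mean w p ∥²
      ≡⟨ cong (λ z → second w′ p′ Q.- ∥ z ∥²)
           (cong₂ _,_ (keep (proj₁ ∘ p) (cong proj₁ (mean₀ dep))) (keep (proj₂ ∘ p) (cong proj₂ (mean₀ dep)))) ⟨
    second w′ p′ Q.- ∥ mean w′ p′ ∥² ∎)
  where
  open ℚₚ.≤-Reasoning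
  v : Fin 4 → ℚ
  v j = w j Q.+ s Q.* μ j
  w′ : Fin 3 → ℚ
  w′ = v ∘ punchIn i
  p′ : Fin 3 → Point
  p′ = p ∘ punchIn i
  moved : ∀ φ → E w′ (φ ∘ punchIn i) ≡ E w φ Q.+ s Q.* E μ φ
  moved φ = trans (sym (E-remove v φ i hit)) (E-axpy w μ φ s)
  keep : ∀ φ → E μ φ ≡ 0ℚ → E w′ (φ ∘ punchIn i) ≡ E w φ
  keep φ eq = trans (moved φ) (trans (cong (λ z → E w φ Q.+ s Q.* z) eq)
    (S.solve 2 (λ e s → e S.:+ s S.:* S.con 0ℚ S.:= e) refl (E w φ) s))

-- Jung's theorem

-- A quantity that can be increased by δ until Good holds, but never exceeds B, reaches Good.
bounded-ascent : {A : Set} (f : A → ℚ) (Good : A → Set) (δ B : ℚ) → 0ℚ Q.< δ →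
  (∀ a → Good a ⊎ ∃[ b ] f a Q.+ δ Q.≤ f b) → (∀ a → f a Q.≤ B) → ∀ a → 0ℚ Q.≤ f a → ∃[ b ] Good b
bounded-ascent {A} f Good δ B 0<δ step f≤B a₀ 0≤fa₀ = conclude (climbs (suc k))
  where
  open ℚₚ.≤-Reasoning
  climbs : ∀ k → (∃[ b ] Good b) ⊎ (∃[ b ] fromℕ k Q.* δ Q.≤ f b)
  climbs zero = inj₂ (a₀ , subst (Q._≤ f a₀) (sym (ℚₚ.*-zeroˡ δ)) 0≤fa₀)
  climbs (suc k) with climbs k
  ... | inj₁ done = inj₁ done
  ... | inj₂ (a , high) with step a
  ... | inj₁ good = inj₁ (a , good)
  ... | inj₂ (b , up) = inj₂ (b , (begin
    fromℕ (suc k) Q.* δ        ≡⟨ cong (Q._* δ) (fromℕ-suc k) ⟩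
    (1ℚ Q.+ fromℕ k) Q.* δ     ≡⟨ S.solve 2 (λ k d → (S.con 1ℚ S.:+ k) S.:* d S.:= k S.:* d S.:+ d) refl (fromℕ k) δ ⟩
    fromℕ k Q.* δ Q.+ δ        ≤⟨ ℚₚ.+-monoˡ-≤ δ high ⟩
    f a Q.+ δ                  ≤⟨ up ⟩
    f b                        ∎))
  r : ℚ
  r = recipℚ δ 0<δ
  k : ℕ
  k = natBound (B Q.* r)
  k<k+1 : fromℕ k Q.< fromℕ (suc k)
  k<k+1 = subst (fromℕ k Q.<_) (sym (fromℕ-suc k))
    (subst (Q._< 1ℚ Q.+ fromℕ k) (ℚₚ.+-identityˡ (fromℕ k)) (ℚₚ.+-monoˡ-< (fromℕ k) 0<1))
  conclude : (∃[ b ] Good b) ⊎ (∃[ b ] fromℕ (suc k) Q.* δ Q.≤ f b) → ∃[ b ] Good b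
  conclude (inj₁ done) = done
  conclude (inj₂ (b , high)) = contradiction (begin-strict
    B                       ≡⟨ ℚₚ.*-identityʳ B ⟨
    B Q.* 1ℚ                ≡⟨ cong (B Q.*_) (recipℚ-inv δ 0<δ) ⟨
    B Q.* (δ Q.* r)         ≡⟨ S.solve 3 (λ a b c → a S.:* (b S.:* c) S.:= (a S.:* c) S.:* b) refl B δ r ⟩
    B Q.* r Q.* δ           ≤⟨ ℚₚ.*-monoʳ-≤-nonNeg δ {{Q.nonNegative (ℚₚ.<⇒≤ 0<δ)}} (≤natBound (B Q.* r)) ⟩
    fromℕ k Q.* δ           <⟨ ℚₚ.*-monoˡ-<-pos δ {{Q.positive 0<δ}} k<k+1 ⟩
    fromℕ (suc k) Q.* δ     ≤⟨ high ⟩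
    f b                     ≤⟨ f≤B b ⟩
    B                       ∎) (ℚₚ.<-irrefl refl)

-- Weight t on a new point, the old weights being scaled by 1 - t.
mix : ∀ {n} → ℚ → (Fin n → ℚ) → Fin (suc n) → ℚ
mix t w = t ∷ (λ i → (1ℚ Q.- t) Q.* w i)

mix-isWeight : ∀ {n t} {w : Fin n → ℚ} → 0ℚ Q.≤ t → t Q.≤ 1ℚ → IsWeight w → IsWeight (mix t w)
mix-isWeight {n} {t} {w} 0≤t t≤1 W = record
  { nonNeg = λ { zero → 0≤t ; (suc i) → 0≤-* (≤⇒0≤- t≤1) (nonNeg W i) }
  ; total  = begin
      t Q.* 1ℚ Q.+ E (λ i → (1ℚ Q.- t) Q.* w i) one  ≡⟨ cong (t Q.* 1ℚ Q.+_) (E-scale w one (1ℚ Q.- t)) ⟩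
      t Q.* 1ℚ Q.+ (1ℚ Q.- t) Q.* E w one            ≡⟨ cong (λ z → t Q.* 1ℚ Q.+ (1ℚ Q.- t) Q.* z) (total W) ⟩
      t Q.* 1ℚ Q.+ (1ℚ Q.- t) Q.* 1ℚ
        ≡⟨ S.solve 1 (λ t → t S.:* S.con 1ℚ S.:+ (S.con 1ℚ S.:- t) S.:* S.con 1ℚ S.:= S.con 1ℚ) refl t ⟩
      1ℚ                                             ∎
  } where open ≡-Reasoning

-- The gain is t(Δ - v - tΔ), where v is the old variance and Δ the squared distance
-- from the new point to the old mean.
var-mix : ∀ {n} t (w : Fin n → ℚ) (p : Fin (suc n) → Point) →
  var (mix t w) p ≡ var w (p ∘ suc) Q.+
    t Q.* (∥ p 0F ∸ᵖ mean w (p ∘ suc) ∥² Q.- var w (p ∘ suc) Q.- t Q.* ∥ p 0F ∸ᵖ mean w (p ∘ suc) ∥²)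
var-mix {n} t w p = trans
  (cong₂ Q._-_ (ext (∥_∥² ∘ p)) (cong ∥_∥² (cong₂ _,_ (ext (proj₁ ∘ p)) (ext (proj₂ ∘ p)))))
  (S.solve 6 (λ t a b x y s →
    let dd = (a S.:- x) S.:* (a S.:- x) S.:+ (b S.:- y) S.:* (b S.:- y)
        v  = s S.:- (x S.:* x S.:+ y S.:* y)
        u  = S.con 1ℚ S.:- t
    in (t S.:* (a S.:* a S.:+ b S.:* b) S.:+ u S.:* s) S.:-
         ((t S.:* a S.:+ u S.:* x) S.:* (t S.:* a S.:+ u S.:* x) S.:+
          (t S.:* b S.:+ u S.:* y) S.:* (t S.:* b S.:+ u S.:* y)) S.:=
       v S.:+ t S.:* (dd S.:- v S.:- t S.:* dd)) refl
    t (proj₁ (p 0F)) (proj₂ (p 0F)) (proj₁ (mean w (p ∘ suc))) (proj₂ (mean w (p ∘ suc))) (second w (p ∘ suc)))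
  where
  ext : ∀ (φ : Fin (suc n) → ℚ) → E (mix t w) φ ≡ t Q.* φ 0F Q.+ (1ℚ Q.- t) Q.* E w (φ ∘ suc)
  ext φ = cong (t Q.* φ 0F Q.+_) (E-scale w (φ ∘ suc) (1ℚ Q.- t))

-- Points p with squared diameter at most D, and a tolerance ε.
module Jung {n} (p : Fin n → Point) (D ε : ℚ) (0≤D : 0ℚ Q.≤ D) (0<ε : 0ℚ Q.< ε)
  (≤D : ∀ i j → ∥ p i ∸ᵖ p j ∥² Q.≤ D) where

  -- Three of the given points, possibly repeated, with weights.
  record Triple : Set where
    field
      index    : Fin 3 → Fin n
      weight   : Fin 3 → ℚ
      isWeight : IsWeight weight
    centre : Point
    centre = mean weight (p ∘ index)
    variance : ℚ
    variance = var weight (p ∘ index)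
  open Triple

  -- The weight t of a new point is chosen such that tM = ε/2, where M = D + ε and D
  -- bounds the squared distance from the given points to a centre.  Then Δ > v + ε gives
  -- t(Δ - v - tΔ) ≥ t(ε - ε/2) = δ.  Taking D + ε and not D keeps M positive and t ≤ 1.
  M t δ : ℚ
  M = D Q.+ ε
  0<M : 0ℚ Q.< M
  0<M = ℚₚ.+-mono-≤-< 0≤D 0<ε
  t = ½ Q.* ε Q.* recipℚ M 0<M
  δ = t Q.* (½ Q.* ε)
  0<t : 0ℚ Q.< t
  0<t = *-pos (0<half 0<ε) (recipℚ-pos M 0<M)
  tM≡ : t Q.* M ≡ ½ Q.* ε
  tM≡ = begin
    ½ Q.* ε Q.* r Q.* M    ≡⟨ S.solve 3 (λ e r m → e S.:* r S.:* m S.:= e S.:* (m S.:* r)) refl (½ Q.* ε) r M ⟩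
    ½ Q.* ε Q.* (M Q.* r)  ≡⟨ cong (½ Q.* ε Q.*_) (recipℚ-inv M 0<M) ⟩
    ½ Q.* ε Q.* 1ℚ         ≡⟨ ℚₚ.*-identityʳ (½ Q.* ε) ⟩
    ½ Q.* ε                ∎
    where
    open ≡-Reasoning
    r : ℚ
    r = recipℚ M 0<M
  t≤1 : t Q.≤ 1ℚ
  t≤1 = ℚₚ.*-cancelʳ-≤-pos M {{Q.positive 0<M}} (begin
    t Q.* M     ≡⟨ tM≡ ⟩
    ½ Q.* ε     ≤⟨ ≤-by (D Q.+ ½ Q.* ε) (0≤-+ 0≤D (ℚₚ.<⇒≤ (0<half 0<ε)))
                     (S.solve 2 (λ d e → S.con 1ℚ S.:* (d S.:+ e) S.:= S.con ½ S.:* e S.:+ (d S.:+ S.con ½ S.:* e))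
                        refl D ε) ⟩
    1ℚ Q.* M    ∎)
    where open ℚₚ.≤-Reasoning
  0<δ : 0ℚ Q.< δ
  0<δ = *-pos 0<t (0<half 0<ε)

  -- The disc about the mean whose squared radius is the variance plus ε contains all points.
  Covers : Triple → Set
  Covers T = ∀ j → ∥ p j ∸ᵖ centre T ∥² Q.≤ variance T Q.+ ε

  improve : ∀ T j → ¬ ∥ p j ∸ᵖ centre T ∥² Q.≤ variance T Q.+ ε → ∃[ T′ ] variance T Q.+ δ Q.≤ variance T′
  improve T j far = record { index = ι ∘ punchIn i ; weight = w′ ; isWeight = W′ } , (begin
    variance T Q.+ t Q.* (½ Q.* ε)
      ≤⟨ ℚₚ.+-monoʳ-≤ (variance T) (ℚₚ.*-monoˡ-≤-nonNeg t {{Q.nonNegative (ℚₚ.<⇒≤ 0<t)}} gain) ⟩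
    variance T Q.+ t Q.* (Δ Q.- variance T Q.- t Q.* Δ)
      ≡⟨ var-mix t (weight T) (p ∘ ι) ⟨
    var (mix t (weight T)) (p ∘ ι)
      ≤⟨ grow ⟩
    var w′ (p ∘ ι ∘ punchIn i) ∎)
    where
    open ℚₚ.≤-Reasoning
    ι : Fin 4 → Fin n
    ι = j ∷ index T
    dropped = drop-point (mix t (weight T)) (p ∘ ι) (mix-isWeight (ℚₚ.<⇒≤ 0<t) t≤1 (isWeight T))
    i    = proj₁ dropped
    w′   = proj₁ (proj₂ dropped)
    W′   = proj₁ (proj₂ (proj₂ dropped))
    grow = proj₂ (proj₂ (proj₂ dropped))
    Δ : ℚ
    Δ = ∥ p j ∸ᵖ centre T ∥²
    tΔ≤ : t Q.* Δ Q.≤ ½ Q.* ε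
    tΔ≤ = begin
      t Q.* Δ   ≤⟨ ℚₚ.*-monoˡ-≤-nonNeg t {{Q.nonNegative (ℚₚ.<⇒≤ 0<t)}}
                     (dist-mean≤ (weight T) (p ∘ index T) (p j) (isWeight T) (λ k → ≤D j (index T k))) ⟩
      t Q.* D   ≤⟨ ℚₚ.*-monoˡ-≤-nonNeg t {{Q.nonNegative (ℚₚ.<⇒≤ 0<t)}} (≤-by ε (ℚₚ.<⇒≤ 0<ε) refl) ⟩
      t Q.* M   ≡⟨ tM≡ ⟩
      ½ Q.* ε   ∎
    gain : ½ Q.* ε Q.≤ Δ Q.- variance T Q.- t Q.* Δ
    gain = ≤-by _ (0≤-+ (≤⇒0≤- (ℚₚ.<⇒≤ (ℚₚ.≰⇒> far))) (≤⇒0≤- tΔ≤))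
      (S.solve 4 (λ d v e u → d S.:- v S.:- u S.:=
         S.con ½ S.:* e S.:+ ((d S.:- (v S.:+ e)) S.:+ (S.con ½ S.:* e S.:- u))) refl Δ (variance T) ε (t Q.* Δ))

  3variance≤D : ∀ T → 3ℚ Q.* variance T Q.≤ D
  3variance≤D T = 3var≤ (weight T) (p ∘ index T) (isWeight T) 0≤D (λ i j → ≤D (index T i) (index T j))

  0≤variance : ∀ T → 0ℚ Q.≤ variance T
  0≤variance T = 0≤var (weight T) (p ∘ index T) (isWeight T)

  variance≤D : ∀ T → variance T Q.≤ D
  variance≤D T = ℚₚ.≤-trans
    (≤-by (variance T Q.+ variance T) (0≤-+ (0≤variance T) (0≤variance T))
      (S.solve 1 (λ v → S.con 3ℚ S.:* v S.:= v S.:+ (v S.:+ v)) refl (variance T)))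
    (3variance≤D T)

  covers-or-improves : ∀ T → Covers T ⊎ ∃[ T′ ] variance T Q.+ δ Q.≤ variance T′
  covers-or-improves T with all? (λ j → ∥ p j ∸ᵖ centre T ∥² ℚₚ.≤? variance T Q.+ ε)
  ... | yes covers = inj₁ covers
  ... | no ¬covers =
    let (j , far) = ¬∀⟶∃¬ n _ (λ j → ∥ p j ∸ᵖ centre T ∥² ℚₚ.≤? variance T Q.+ ε) ¬covers
    in inj₂ (improve T j far)

  -- The starting point of the ascent: all weight on one point.
  single : Fin n → Triple
  single o = record
    { index    = λ _ → o
    ; weight   = 1ℚ ∷ 0ℚ ∷ 0ℚ ∷ []
    ; isWeight = record
        { nonNeg = λ { 0F → 0≤1 ; 1F → ℚₚ.≤-refl ; 2F → ℚₚ.≤-refl }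
        ; total  = refl }
    }

  covering : Fin n → ∃[ T ] Covers T
  covering o = bounded-ascent variance Covers δ D 0<δ covers-or-improves variance≤D (single o) (0≤variance (single o))

-- Jung's theorem for rational points, with the squared radius at most D/3 + ε.
-- The argument Fin n says that there is a point.
jung : ∀ {n} (p : Fin n → Point) → Fin n → ∀ D ε → 0ℚ Q.< ε → (∀ i j → ∥ p i ∸ᵖ p j ∥² Q.≤ D) →
  ∃[ c ] ∀ i → 3ℚ Q.* ∥ p i ∸ᵖ c ∥² Q.≤ D Q.+ 3ℚ Q.* ε
jung p o D ε 0<ε ≤D = centre T , λ i → begin
  3ℚ Q.* ∥ p i ∸ᵖ centre T ∥²       ≤⟨ ℚₚ.*-monoˡ-≤-nonNeg 3ℚ (covers i) ⟩
  3ℚ Q.* (variance T Q.+ ε)            ≡⟨ ℚₚ.*-distribˡ-+ 3ℚ (variance T) ε ⟩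
  3ℚ Q.* variance T Q.+ 3ℚ Q.* ε       ≤⟨ ℚₚ.+-monoˡ-≤ (3ℚ Q.* ε) (3variance≤D T) ⟩
  D Q.+ 3ℚ Q.* ε                    ∎
  where
  open ℚₚ.≤-Reasoning
  open Jung p D ε (ℚₚ.≤-trans (0≤∥∥² (p o ∸ᵖ p o)) (≤D o o)) 0<ε ≤D
  open Triple
  T : Triple
  T = proj₁ (covering o)
  covers : Covers T
  covers = proj₂ (covering o)

-- Eventual statements and the order on the reals

eventually-zip : ∀ {P P′ R : ℕ → Set} → (∀ n → P n → P′ n → R n) → Eventually P → Eventually P′ → Eventually R
eventually-zip f (M , p) (N , p′) = M ℕ.⊔ N , λ n le →
  f n (p n (ℕₚ.m⊔n≤o⇒m≤o M N le)) (p′ n (ℕₚ.m⊔n≤o⇒n≤o M N le))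

eventually-map : ∀ {P R : ℕ → Set} → (∀ n → P n → R n) → Eventually P → Eventually R
eventually-map f (N , p) = N , λ n le → f n (p n le)

eventually-all : ∀ {k} {P : Fin k → ℕ → Set} → (∀ i → Eventually (P i)) → Eventually (λ n → ∀ i → P i n)
eventually-all {zero}  ev = 0 , λ _ _ ()
eventually-all {suc k} {P} ev = eventually-zip (λ { n p ps zero → p ; n p ps (suc i) → ps i })
  (ev zero) (eventually-all {k} {P ∘ suc} (ev ∘ suc))

≤-trans : ∀ {x y z} → x ≤ y → y ≤ z → x ≤ z
≤-trans {x} {y} {z} x≤y y≤z ε 0<ε = eventually-zip (λ n p q → begin
    seq x n                           ≤⟨ p ⟩
    seq y n Q.+ ½ Q.* ε               ≤⟨ ℚₚ.+-monoˡ-≤ (½ Q.* ε) q ⟩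
    seq z n Q.+ ½ Q.* ε Q.+ ½ Q.* ε   ≡⟨ ℚₚ.+-assoc (seq z n) (½ Q.* ε) (½ Q.* ε) ⟩
    seq z n Q.+ (½ Q.* ε Q.+ ½ Q.* ε) ≡⟨ cong (seq z n Q.+_) (half ε) ⟩
    seq z n Q.+ ε                     ∎)
  (x≤y (½ Q.* ε) (0<half 0<ε)) (y≤z (½ Q.* ε) (0<half 0<ε))
  where open ℚₚ.≤-Reasoning

≤-ptwise : ∀ {x y} → (∀ n → seq x n Q.≤ seq y n) → x ≤ y
≤-ptwise le ε 0<ε = 0 , λ n _ → ℚₚ.≤-trans (le n) (≤-by ε (ℚₚ.<⇒≤ 0<ε) refl)

-- An inequality may be proved up to an arbitrarily small rational.
≤-up-to : ∀ {x y} → (∀ ε → 0ℚ Q.< ε → x ≤ y + fromℚ ε) → x ≤ y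
≤-up-to {x} {y} h ε 0<ε = eventually-map (λ n p → begin
    seq x n                           ≤⟨ p ⟩
    seq y n Q.+ ½ Q.* ε Q.+ ½ Q.* ε   ≡⟨ ℚₚ.+-assoc (seq y n) (½ Q.* ε) (½ Q.* ε) ⟩
    seq y n Q.+ (½ Q.* ε Q.+ ½ Q.* ε) ≡⟨ cong (seq y n Q.+_) (half ε) ⟩
    seq y n Q.+ ε                     ∎)
  (h (½ Q.* ε) (0<half 0<ε) (½ Q.* ε) (0<half 0<ε))
  where open ℚₚ.≤-Reasoning

x≤x⊔y : ∀ {x y} → x ≤ x ⊔ y
x≤x⊔y {x} {y} = ≤-ptwise {x} {x ⊔ y} λ n → ℚₚ.p≤p⊔q (seq x n) (seq y n)

y≤x⊔y : ∀ {x y} → y ≤ x ⊔ y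
y≤x⊔y {x} {y} = ≤-ptwise {y} {x ⊔ y} λ n → ℚₚ.p≤q⊔p (seq x n) (seq y n)

⊔-lub : ∀ {x y z} → x ≤ z → y ≤ z → x ⊔ y ≤ z
⊔-lub x≤z y≤z ε 0<ε = eventually-zip (λ n → ℚₚ.⊔-lub) (x≤z ε 0<ε) (y≤z ε 0<ε)

-- From some stage N on, the later terms differ from the N-th by at most η.
settles : ∀ x {η} → 0ℚ Q.< η → Eventually λ N → ∀ n → N ℕ.≤ n → Q.∣ seq x n Q.- seq x N ∣ Q.≤ η
settles x {η} 0<η = let (M , c) = cauchy x η 0<η in
  M , λ N M≤N n N≤n → c n N (ℕₚ.≤-trans M≤N N≤n) M≤N

-- Distances and widths

-- The n-th rational approximation of a point.
at : ℕ → ℝ² → Point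
at n (x , y) = seq x n , seq y n

d-≤ : ∀ {P P′ n B} → 0ℚ Q.≤ B → ∥ at n P ∸ᵖ at n P′ ∥² Q.≤ B Q.* B → seq (d P P′) n Q.≤ B
d-≤ {P} {P′} {n} {B} 0≤B le = ²-cancel-≤ 0≤B (ℚₚ.≤-trans
  (proj₁ (proj₂ (rootℚ-spec z n (ℚₚ.p≤q⊔p ∥ at n P ∸ᵖ at n P′ ∥² 0ℚ))))
  (ℚₚ.⊔-lub le (0≤-² B)))
  where
  z : ℚ
  z = ∥ at n P ∸ᵖ at n P′ ∥² Q.⊔ 0ℚ

-- The termwise square root is short of the true one by less than the mesh.
d-≥ : ∀ {P P′ n B} → seq (d P P′) n Q.≤ B → 0ℚ Q.≤ B Q.+ mesh n ×
  ∥ at n P ∸ᵖ at n P′ ∥² Q.≤ (B Q.+ mesh n) Q.* (B Q.+ mesh n)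
d-≥ {P} {P′} {n} {B} le =
  let (0≤r , _ , hi) = rootℚ-spec (y Q.⊔ 0ℚ) n (ℚₚ.p≤q⊔p y 0ℚ)
      0≤m = ℚₚ.<⇒≤ (0<mesh n)
  in 0≤-+ (ℚₚ.≤-trans 0≤r le) 0≤m
   , ℚₚ.≤-trans (ℚₚ.p≤p⊔q y 0ℚ) (ℚₚ.≤-trans (ℚₚ.<⇒≤ hi)
       (sq-mono (0≤-+ 0≤r 0≤m) (ℚₚ.+-monoˡ-≤ (mesh n) le)))
  where
  y : ℚ
  y = ∥ at n P ∸ᵖ at n P′ ∥²

translate : Point → ℝ² → ℝ²
translate (a , b) (x , y) = x - fromℚ a , y - fromℚ b

d-translate : ∀ c P P′ n → seq (d (translate c P) (translate c P′)) n ≡ seq (d P P′) n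
d-translate (a , b) (x , y) (x′ , y′) n = cong (λ z → rootℚ (z Q.⊔ 0ℚ) n)
  (cong₂ (λ p q → p Q.* p Q.+ q Q.* q) (cancel (seq x n) (seq x′ n) a) (cancel (seq y n) (seq y′ n) b))
  where
  cancel : ∀ p q a → (p Q.- a) Q.- (q Q.- a) ≡ p Q.- q
  cancel = S.solve 3 (λ p q a → (p S.:- a) S.:- (q S.:- a) S.:= p S.:- q) refl

module _ {A : Set} (f : A → ℝ) where

  ≤-foldr-⊔ : ∀ {a xs} → a ∈ xs → f a ≤ List.foldr _⊔_ 0ℝ (List.map f xs)
  ≤-foldr-⊔ {a} {x List.∷ xs} (here refl) = x≤x⊔y {f a} {List.foldr _⊔_ 0ℝ (List.map f xs)}
  ≤-foldr-⊔ {a} {x List.∷ xs} (there a∈) =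
    ≤-trans {f a} {List.foldr _⊔_ 0ℝ (List.map f xs)} {f x ⊔ List.foldr _⊔_ 0ℝ (List.map f xs)}
    (≤-foldr-⊔ a∈) (y≤x⊔y {f x} {List.foldr _⊔_ 0ℝ (List.map f xs)})

  foldr-⊔-≤ : ∀ {z} → 0ℝ ≤ z → (∀ a → f a ≤ z) → ∀ xs → List.foldr _⊔_ 0ℝ (List.map f xs) ≤ z
  foldr-⊔-≤ 0≤z le List.[] = 0≤z
  foldr-⊔-≤ {z} 0≤z le (x List.∷ xs) =
    ⊔-lub {f x} {List.foldr _⊔_ 0ℝ (List.map f xs)} {z} (le x) (foldr-⊔-≤ {z} 0≤z le xs)

module _ (G : Graph) where
  open Graph G

  ∈-vertices : ∀ u → u ∈ vertices
  ∈-vertices u = subst (_∈ vertices) (Inverse.strictlyInverseʳ finite u)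
    (∈-map⁺ (Inverse.from finite) (∈-allFin (Inverse.to finite u)))

  module _ (R : Realization G) where
    open Realization R

    d≤width : ∀ u v → d (r u) (r v) ≤ width G R
    d≤width u v = ≤-foldr-⊔ (λ (u , v) → d (r u) (r v)) (∈-cartesianProduct⁺ (∈-vertices u) (∈-vertices v))

    width≤ : ∀ {z} → (∀ u v → d (r u) (r v) ≤ z) → width G R ≤ z
    width≤ {z} le = foldr-⊔-≤ (λ (u , v) → d (r u) (r v)) {z}
      (≤-trans {0ℝ} {d (r u₀) (r u₀)} {z}
        (≤-ptwise {0ℝ} {d (r u₀) (r u₀)} λ n →
          proj₁ (rootℚ-spec _ n (ℚₚ.p≤q⊔p ∥ at n (r u₀) ∸ᵖ at n (r u₀) ∥² 0ℚ)))
        (le u₀ u₀))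
      (λ (u , v) → le u v) (List.cartesianProduct vertices vertices)
      where u₀ = proj₁ edge

-- The constant 1/√3

-- The approximations of 1/√3.
σ : ℕ → ℚ
σ = seq 1/√3

module _ (n : ℕ) where
  -- The term whose reciprocal is σ n; the recorded positive lower bound of √3 is ½.
  private
    T : ℚ
    T = seq (√ 3ℝ) n Q.⊔ ½
    0<T : 0ℚ Q.< T
    0<T = 0<⊔ (ℚₚ.positive⁻¹ ½) (seq (√ 3ℝ) n)
    inv : T Q.* σ n ≡ 1ℚ
    inv = recipℚ-inv T 0<T

  0≤σ : 0ℚ Q.≤ σ n
  0≤σ = ℚₚ.<⇒≤ (recipℚ-pos T 0<T)

  σ≤2 : σ n Q.≤ fromℕ 2
  σ≤2 = ℚₚ.*-cancelˡ-≤-pos ½ (begin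
    ½ Q.* σ n   ≤⟨ ℚₚ.*-monoʳ-≤-nonNeg (σ n) {{Q.nonNegative 0≤σ}} (ℚₚ.p≤q⊔p (seq (√ 3ℝ) n) ½) ⟩
    T Q.* σ n   ≡⟨ inv ⟩
    1ℚ          ∎)
    where open ℚₚ.≤-Reasoning

  -- The approximations of √3, also when raised to ½, are at most √3, and so those of
  -- 1/√3 are at least 1/√3, at every stage.
  1≤3σ² : 1ℚ Q.≤ 3ℚ Q.* (σ n Q.* σ n)
  1≤3σ² = begin
    1ℚ                              ≡⟨ cong (λ z → z Q.* z) inv ⟨
    (T Q.* σ n) Q.* (T Q.* σ n)
      ≡⟨ S.solve 2 (λ t s → (t S.:* s) S.:* (t S.:* s) S.:= (t S.:* t) S.:* (s S.:* s)) refl T (σ n) ⟩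
    (T Q.* T) Q.* (σ n Q.* σ n)     ≤⟨ ℚₚ.*-monoʳ-≤-nonNeg (σ n Q.* σ n) {{Q.nonNegative (0≤-² (σ n))}} T²≤3 ⟩
    3ℚ Q.* (σ n Q.* σ n)            ∎
    where
    open ℚₚ.≤-Reasoning
    T²≤3 : T Q.* T Q.≤ 3ℚ
    T²≤3 with ℚₚ.⊔-sel (seq (√ 3ℝ) n) ½
    ... | inj₁ eq = subst (λ z → z Q.* z Q.≤ 3ℚ) (sym eq)
      (proj₁ (proj₂ (rootℚ-spec 3ℚ n (ℚₚ.nonNegative⁻¹ 3ℚ))))
    ... | inj₂ eq = subst (λ z → z Q.* z Q.≤ 3ℚ) (sym eq) (ℚₚ.p≤p⊔q (½ Q.* ½) 3ℚ)

-- Jung's theorem for realizations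

-- At stage N, the radius w/√3 with a margin for the tolerance η.  The diameter is known
-- up to 2η, which changes the radius by at most 2ησ ≤ 4η; Jung's theorem costs η, and
-- the movement of the points after stage N costs 2η.
radius : ℝ → ℚ → ℕ → ℚ
radius w η N = σ N Q.* seq w N Q.+ fromℕ 7 Q.* η

module _ (G : Graph) (R : Realization G) (w : ℝ) (width≤w : width G R ≤ w) where
  open Graph G
  open Realization R

  -- There is a rational centre such that at all stages n ≥ N every vertex lies within
  -- the radius taken at stage N.
  Centred : ℚ → ℕ → Set
  Centred η N = ∃[ c ] 0ℚ Q.≤ radius w η N × (∀ n → N ℕ.≤ n → ∀ u →
    ∥ at n (r u) ∸ᵖ c ∥² Q.≤ radius w η N Q.* radius w η N)

  jung-realization : ∀ {η} → 0ℚ Q.< η → Eventually (Centred η)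
  jung-realization {η} 0<η = eventually-zip centre
    (eventually-zip {R = Tame} (λ N a b → a , b) calm (mesh-small η 0<η)) close
    where
    pt : Fin order → ℝ²
    pt i = r (Inverse.from finite i)
    0≤η : 0ℚ Q.≤ η
    0≤η = ℚₚ.<⇒≤ 0<η

    -- x moves by at most η after stage N.
    Still : ℕ → ℝ → Set
    Still N x = ∀ n → N ℕ.≤ n → Q.∣ seq x n Q.- seq x N ∣ Q.≤ η
    Tame Close : ℕ → Set
    Tame N = (∀ i → Still N (proj₁ (pt i)) × Still N (proj₂ (pt i))) × mesh N Q.≤ η
    Close N = ∀ i j → seq (d (pt i) (pt j)) N Q.≤ seq w N Q.+ η

    calm : Eventually λ N → ∀ i → Still N (proj₁ (pt i)) × Still N (proj₂ (pt i))
    calm = eventually-all λ i → eventually-zip (λ _ → _,_) (settles (proj₁ (pt i)) 0<η) (settles (proj₂ (pt i)) 0<η)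
    close : Eventually Close
    close = eventually-all λ i → eventually-all λ j →
      ≤-trans {d (pt i) (pt j)} {width G R} {w} (d≤width G R _ _) width≤w η 0<η

    centre : ∀ N → Tame N → Close N → Centred η N
    centre N (still , mesh≤η) close = c , 0≤ρ , λ n N≤n u →
      subst (λ u → ∥ at n (r u) ∸ᵖ c ∥² Q.≤ ρ Q.* ρ) (Inverse.strictlyInverseʳ finite u)
        (within n N≤n (Inverse.to finite u))
      where
      open ℚₚ.≤-Reasoning
      g W α ρ : ℚ
      g = seq w N
      W = g Q.+ η Q.+ η
      α = σ N Q.* W Q.+ η
      ρ = radius w η N
      o : Fin order
      o = Inverse.to finite (proj₁ edge)
      q : Fin order → Point
      q i = at N (pt i)
      shrink : g Q.+ η Q.+ mesh N Q.≤ W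
      shrink = ℚₚ.+-monoʳ-≤ (g Q.+ η) mesh≤η
      0≤W : 0ℚ Q.≤ W
      0≤W = ℚₚ.≤-trans (proj₁ (d-≥ {pt o} {pt o} {N} (close o o))) shrink
      0≤α : 0ℚ Q.≤ α
      0≤α = 0≤-+ (0≤-* (0≤σ N) 0≤W) 0≤η
      diam : ∀ i j → ∥ q i ∸ᵖ q j ∥² Q.≤ W Q.* W
      diam i j = let (0≤ , le) = d-≥ {pt i} {pt j} {N} (close i j) in ℚₚ.≤-trans le (sq-mono 0≤ shrink)
      J : ∃[ c ] ∀ i → 3ℚ Q.* ∥ q i ∸ᵖ c ∥² Q.≤ W Q.* W Q.+ 3ℚ Q.* (η Q.* η)
      J = jung q o (W Q.* W) (η Q.* η) (*-pos 0<η 0<η) diam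
      c : Point
      c = proj₁ J
      near : ∀ i → ∥ q i ∸ᵖ c ∥² Q.≤ α Q.* α
      near i = ℚₚ.*-cancelˡ-≤-pos 3ℚ (begin
        3ℚ Q.* ∥ q i ∸ᵖ c ∥²
          ≤⟨ proj₂ J i ⟩
        W Q.* W Q.+ 3ℚ Q.* (η Q.* η)
          ≡⟨ cong (Q._+ 3ℚ Q.* (η Q.* η)) (ℚₚ.*-identityˡ (W Q.* W)) ⟨
        1ℚ Q.* (W Q.* W) Q.+ 3ℚ Q.* (η Q.* η)
          ≤⟨ ℚₚ.+-monoˡ-≤ (3ℚ Q.* (η Q.* η)) (ℚₚ.*-monoʳ-≤-nonNeg (W Q.* W) {{Q.nonNegative (0≤-² W)}} (1≤3σ² N)) ⟩
        3ℚ Q.* (σ N Q.* σ N) Q.* (W Q.* W) Q.+ 3ℚ Q.* (η Q.* η)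
          ≤⟨ ≤-by (fromℕ 6 Q.* (σ N Q.* W Q.* η)) (0≤-* (0≤fromℕ 6) (0≤-* (0≤-* (0≤σ N) 0≤W) 0≤η))
               (S.solve 3 (λ s W η → S.con 3ℚ S.:* ((s S.:* W S.:+ η) S.:* (s S.:* W S.:+ η)) S.:=
                  S.con 3ℚ S.:* (s S.:* s) S.:* (W S.:* W) S.:+ S.con 3ℚ S.:* (η S.:* η) S.:+
                  S.con (fromℕ 6) S.:* (s S.:* W S.:* η)) refl (σ N) W η) ⟩
        3ℚ Q.* (α Q.* α) ∎)
      2η+α≤ρ : η Q.+ η Q.+ α Q.≤ ρ
      2η+α≤ρ = ≤-by ((fromℕ 2 Q.- σ N) Q.* (η Q.+ η)) (0≤-* (≤⇒0≤- (σ≤2 N)) (0≤-+ 0≤η 0≤η))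
        (S.solve 3 (λ s g η → s S.:* g S.:+ S.con (fromℕ 7) S.:* η S.:=
           η S.:+ η S.:+ (s S.:* (g S.:+ η S.:+ η) S.:+ η) S.:+ (S.con (fromℕ 2) S.:- s) S.:* (η S.:+ η))
           refl (σ N) g η)
      0≤2η+α : 0ℚ Q.≤ η Q.+ η Q.+ α
      0≤2η+α = 0≤-+ (0≤-+ 0≤η 0≤η) 0≤α
      0≤ρ : 0ℚ Q.≤ ρ
      0≤ρ = ℚₚ.≤-trans 0≤2η+α 2η+α≤ρ
      drift² : ∀ {z} → Q.∣ z ∣ Q.≤ η → z Q.* z Q.≤ η Q.* η
      drift² {z} le = begin
        z Q.* z               ≡⟨ ∣z∣² ⟨
        Q.∣ z ∣ Q.* Q.∣ z ∣   ≤⟨ sq-mono (ℚₚ.0≤∣p∣ z) le ⟩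
        η Q.* η               ∎
        where
        ∣z∣² : Q.∣ z ∣ Q.* Q.∣ z ∣ ≡ z Q.* z
        ∣z∣² = trans (sym (ℚₚ.∣p*q∣≡∣p∣*∣q∣ z z)) (ℚₚ.0≤p⇒∣p∣≡p (0≤-² z))
      drift : ∀ n → N ℕ.≤ n → ∀ i → ∥ at n (pt i) ∸ᵖ q i ∥² Q.≤ (η Q.+ η) Q.* (η Q.+ η)
      drift n N≤n i = ℚₚ.≤-trans
        (ℚₚ.+-mono-≤ (drift² (proj₁ (still i) n N≤n)) (drift² (proj₂ (still i) n N≤n)))
        (≤-by (η Q.* η Q.+ η Q.* η) (0≤-+ (0≤-² η) (0≤-² η))
          (S.solve 1 (λ η → (η S.:+ η) S.:* (η S.:+ η) S.:=
             (η S.:* η S.:+ η S.:* η) S.:+ (η S.:* η S.:+ η S.:* η)) refl η))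
      telescope : ∀ a b c → a ∸ᵖ c ≡ (a ∸ᵖ b) ∸ᵖ (c ∸ᵖ b)
      telescope (a , a′) (b , b′) (c , c′) = cong₂ _,_ (line a b c) (line a′ b′ c′)
        where
        line : ∀ a b c → a Q.- c ≡ (a Q.- b) Q.- (c Q.- b)
        line = S.solve 3 (λ a b c → a S.:- c S.:= (a S.:- b) S.:- (c S.:- b)) refl
      within : ∀ n → N ℕ.≤ n → ∀ i → ∥ at n (pt i) ∸ᵖ c ∥² Q.≤ ρ Q.* ρ
      within n N≤n i = begin
        ∥ at n (pt i) ∸ᵖ c ∥²
          ≡⟨ cong ∥_∥² (telescope (at n (pt i)) (q i) c) ⟩
        ∥ (at n (pt i) ∸ᵖ q i) ∸ᵖ (c ∸ᵖ q i) ∥²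
          ≤⟨ ∥∥²-triangle {at n (pt i) ∸ᵖ q i} {c ∸ᵖ q i} (0≤-+ 0≤η 0≤η) 0≤α
               (drift n N≤n i) (subst (Q._≤ α Q.* α) (∥∥²-flip (q i) c) (near i)) ⟩
        (η Q.+ η Q.+ α) Q.* (η Q.+ η Q.+ α)
          ≤⟨ sq-mono 0≤2η+α 2η+α≤ρ ⟩
        ρ Q.* ρ ∎

-- Superposing two realizations

module _ (G H : Graph) (R : Realization G) (R′ : Realization H) (c c′ : Point) where
  private
    module R  = Realization R
    module R′ = Realization R′

  -- The two realizations, translated so that c and c′ come to the origin.
  superpose : Realization (G ⊎ᵍ H)
  superpose = record
    { r         = λ { (inj₁ u) → translate c (R.r u) ; (inj₂ v) → translate c′ (R′.r v) }
    ; separated = λ { (inj₁ {u} {u′} e) → shift c {R.r u} {R.r u′} (R.separated e)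
                    ; (inj₂ {v} {v′} e) → shift c′ {R′.r v} {R′.r v′} (R′.separated e) }
    }
    where
    shift : ∀ c {P P′} → 1ℝ ≤ d P P′ → 1ℝ ≤ d (translate c P) (translate c P′)
    shift c {P} {P′} 1≤ = ≤-trans {1ℝ} {d P P′} {d (translate c P) (translate c P′)} 1≤
      (≤-ptwise {d P P′} {d (translate c P) (translate c P′)} λ n → ℚₚ.≤-reflexive (sym (d-translate c P P′ n)))

-- With both centres moved to the origin at a common stage N, all distances are at
-- most the bound of the theorem up to 15η: 7η for each of the two radii, and η for
-- the movement of the term with 1/√3 after stage N.
module Superposition (G H : Graph) (g h : ℝ)
  (RG : Realization G) (widthG : width G RG ≤ g) (RH : Realization H) (widthH : width H RH ≤ h)
  (η : ℚ) (0≤η : 0ℚ Q.≤ η) (N : ℕ)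
  (centredG : Centred G RG g widthG η N) (centredH : Centred H RH h widthH η N)
  (still : ∀ n → N ℕ.≤ n → Q.∣ seq (1/√3 * (g + h)) n Q.- seq (1/√3 * (g + h)) N ∣ Q.≤ η) where

  module RG = Realization RG
  module RH = Realization RH

  z bound slack : ℝ
  z     = 1/√3 * (g + h)
  bound = g ⊔ h ⊔ z
  slack = bound + fromℚ (fromℕ 15 Q.* η)

  c c′ : Point
  c  = proj₁ centredG
  c′ = proj₁ centredH

  ρ ρ′ : ℚ
  ρ  = radius g η N
  ρ′ = radius h η N

  R : Realization (G ⊎ᵍ H)
  R = superpose G H RG RH c c′

  inside : ∀ {x y} c {P P′} → d P P′ ≤ x → x ≤ y → y ≤ g ⊔ h → d (translate c P) (translate c P′) ≤ slack
  inside {x} {y} c {P} {P′} p q r =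
    ≤-trans {D′} {D} {slack} (≤-ptwise {D′} {D} λ n → ℚₚ.≤-reflexive (d-translate c P P′ n))
    (≤-trans {D} {x} {slack} p (≤-trans {x} {y} {slack} q (≤-trans {y} {g ⊔ h} {slack} r
    (≤-trans {g ⊔ h} {bound} {slack} (x≤x⊔y {g ⊔ h} {z})
      (≤-ptwise {bound} {slack} λ n → ≤-by (fromℕ 15 Q.* η) (0≤-* (0≤fromℕ 15) 0≤η) refl)))))
    where
    D D′ : ℝ
    D  = d P P′
    D′ = d (translate c P) (translate c P′)

  ρ+ρ′≤ : ∀ n → N ℕ.≤ n → ρ Q.+ ρ′ Q.≤ seq slack n
  ρ+ρ′≤ n N≤n = begin
    ρ Q.+ ρ′
      ≡⟨ S.solve 4 (λ s g h η →
           (s S.:* g S.:+ S.con (fromℕ 7) S.:* η) S.:+ (s S.:* h S.:+ S.con (fromℕ 7) S.:* η) S.:=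
           s S.:* (g S.:+ h) S.:+ S.con (fromℕ 14) S.:* η) refl (σ N) (seq g N) (seq h N) η ⟩
    seq z N Q.+ fromℕ 14 Q.* η
      ≤⟨ ℚₚ.+-monoˡ-≤ (fromℕ 14 Q.* η) (∣-∣≤⇒≤ {seq z N} {seq z n}
           (subst (Q._≤ η) (flip (seq z n) (seq z N)) (still n N≤n))) ⟩
    seq z n Q.+ η Q.+ fromℕ 14 Q.* η
      ≡⟨ S.solve 2 (λ z η → z S.:+ η S.:+ S.con (fromℕ 14) S.:* η S.:=
           z S.:+ S.con (fromℕ 15) S.:* η) refl (seq z n) η ⟩
    seq z n Q.+ fromℕ 15 Q.* η
      ≤⟨ ℚₚ.+-monoˡ-≤ (fromℕ 15 Q.* η) (ℚₚ.p≤q⊔p (seq (g ⊔ h) n) (seq z n)) ⟩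
    seq slack n ∎
    where
    open ℚₚ.≤-Reasoning
    flip : ∀ a b → Q.∣ a Q.- b ∣ ≡ Q.∣ b Q.- a ∣
    flip a b = trans (cong Q.∣_∣ (S.solve 2 (λ a b → a S.:- b S.:= S.:- (b S.:- a)) refl a b))
      (ℚₚ.∣-p∣≡∣p∣ (b Q.- a))

  across² : ∀ n → N ℕ.≤ n → ∀ u v →
    ∥ at n (translate c (RG.r u)) ∸ᵖ at n (translate c′ (RH.r v)) ∥² Q.≤ (ρ Q.+ ρ′) Q.* (ρ Q.+ ρ′)
  across² n N≤n u v = ∥∥²-triangle {at n (RG.r u) ∸ᵖ c} {at n (RH.r v) ∸ᵖ c′}
    (proj₁ (proj₂ centredG)) (proj₁ (proj₂ centredH))
    (proj₂ (proj₂ centredG) n N≤n u) (proj₂ (proj₂ centredH) n N≤n v)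

  -- Distances that are at most ρ + ρ′ from stage N on, as between a vertex of G and one of H.
  across : ∀ P P′ → (∀ n → N ℕ.≤ n → ∥ at n P ∸ᵖ at n P′ ∥² Q.≤ (ρ Q.+ ρ′) Q.* (ρ Q.+ ρ′)) → d P P′ ≤ slack
  across P P′ le ε 0<ε = N , λ n N≤n → ℚₚ.≤-trans
    (d-≤ {P} {P′} {n} (0≤-+ (proj₁ (proj₂ centredG)) (proj₁ (proj₂ centredH))) (le n N≤n))
    (ℚₚ.≤-trans (ρ+ρ′≤ n N≤n) (≤-by ε (ℚₚ.<⇒≤ 0<ε) refl))

  d≤slack : ∀ x y → d (Realization.r R x) (Realization.r R y) ≤ slack
  d≤slack (inj₁ u) (inj₁ u′) = inside {width G RG} {g} c {RG.r u} {RG.r u′}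
    (d≤width G RG u u′) widthG (x≤x⊔y {g} {h})
  d≤slack (inj₂ v) (inj₂ v′) = inside {width H RH} {h} c′ {RH.r v} {RH.r v′}
    (d≤width H RH v v′) widthH (y≤x⊔y {g} {h})
  d≤slack (inj₁ u) (inj₂ v) = across (translate c (RG.r u)) (translate c′ (RH.r v)) λ n N≤n → across² n N≤n u v
  d≤slack (inj₂ v) (inj₁ u) = across (translate c′ (RH.r v)) (translate c (RG.r u)) λ n N≤n →
    subst (Q._≤ (ρ Q.+ ρ′) Q.* (ρ Q.+ ρ′))
      (∥∥²-flip (at n (translate c (RG.r u))) (at n (translate c′ (RH.r v)))) (across² n N≤n u v)

-- The upper bound for widths g and h that need not be minimal.
superposition : ∀ G H g h → (RG : Realization G) → width G RG ≤ g → (RH : Realization H) → width H RH ≤ h →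
  ∀ {ε} → 0ℚ Q.< ε → ∃[ R ] width (G ⊎ᵍ H) R ≤ g ⊔ h ⊔ 1/√3 * (g + h) + fromℚ ε
superposition G H g h RG widthG RH widthH {ε} 0<ε =
  subst (λ ε → ∃[ R ] width (G ⊎ᵍ H) R ≤ g ⊔ h ⊔ z + fromℚ ε) 15η≡ε
    (build (proj₁ stage) (proj₂ stage _ ℕₚ.≤-refl))
  where
  z : ℝ
  z = 1/√3 * (g + h)
  η : ℚ
  η = recipℚ (fromℕ 15) (0<fromℕ 14) Q.* ε
  0<η : 0ℚ Q.< η
  0<η = *-pos (recipℚ-pos (fromℕ 15) (0<fromℕ 14)) 0<ε
  15η≡ε : fromℕ 15 Q.* η ≡ ε
  15η≡ε = trans (sym (ℚₚ.*-assoc (fromℕ 15) (recipℚ (fromℕ 15) (0<fromℕ 14)) ε))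
    (trans (cong (Q._* ε) (recipℚ-inv (fromℕ 15) (0<fromℕ 14))) (ℚₚ.*-identityˡ ε))
  Ready : ℕ → Set
  Ready N = (Centred G RG g widthG η N × Centred H RH h widthH η N) ×
            (∀ n → N ℕ.≤ n → Q.∣ seq z n Q.- seq z N ∣ Q.≤ η)
  stage : Eventually Ready
  stage = eventually-zip (λ _ → _,_)
    (eventually-zip (λ _ → _,_) (jung-realization G RG g widthG 0<η) (jung-realization H RH h widthH 0<η))
    (settles z 0<η)
  build : ∀ N → Ready N → ∃[ R ] width (G ⊎ᵍ H) R ≤ g ⊔ h ⊔ z + fromℚ (fromℕ 15 Q.* η)
  build N ((cG , cH) , still) = M.R , width≤ (G ⊎ᵍ H) M.R {M.slack} M.d≤slack
    where module M = Superposition G H g h RG widthG RH widthH η (ℚₚ.<⇒≤ 0<η) N cG cH still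

theorem5p8 : (G H : Graph) (pwG pwH pwG⊎H : ℝ) →
    IsPlaneWidth G pwG → IsPlaneWidth H pwH → IsPlaneWidth (G ⊎ᵍ H) pwG⊎H →
    pwG⊎H ≤ pwG ⊔ pwH ⊔ 1/√3 * (pwG + pwH)
theorem5p8 G H pwG pwH pwG⊎H isG isH isG⊎H = ≤-up-to {pwG⊎H} {bound} λ ε 0<ε →
  let (R , R≤) = superposition G H pwG pwH RG (proj₁ RG≈) RH (proj₁ RH≈) 0<ε
  in ≤-trans {pwG⊎H} {width (G ⊎ᵍ H) R} {bound + fromℚ ε} (IsPlaneWidth.minimal isG⊎H R) R≤
  where
  bound : ℝ
  bound = pwG ⊔ pwH ⊔ 1/√3 * (pwG + pwH)
  RG : Realization G
  RG = proj₁ (IsPlaneWidth.attained isG)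
  RG≈ : width G RG ≈ pwG
  RG≈ = proj₂ (IsPlaneWidth.attained isG)
  RH : Realization H
  RH = proj₁ (IsPlaneWidth.attained isH)
  RH≈ : width H RH ≈ pwH
  RH≈ = proj₂ (IsPlaneWidth.attained isH)
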